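{- Let $p>10$ be a prime. For real $a<b$ write $\big(\frac{\prod}{p}\big)(a,b)=\prod_{x\in\mathbb Z,\ a<x<b}\big(\frac{x}{p}\big)$, let $\#N_p(6)$ be the number of quadratic non-residues modulo $p$ among the integers in $(p/12,p/6)\cup(p/4,p/3)\cup(5p/12,p/2)$, and $k\in\mathbb Z_{\ge0}$. (i) $(-1)^{\#N_p(6)}=\big(\frac{\prod}{p}\big)(p/4,p/3)$ if $p\equiv1\pmod4$, and $(-1)^{\#N_p(6)}=\big(\frac{3}{p}\big)\big(\frac{\prod}{p}\big)(p/4,p/3)$ if $p\equiv3\pmod 4$. (ii) $$(-1)^{\#N_p(6)}=\begin{cases}\big(\frac{\prod}{p}\big)(0,p/12) & p=1+24k,\\ (-1)^{k+1} & p=19+24k,\\ (-1)^{k+1} & p=23+24k,\\ (-1)^k\big(\frac{\prod}{p}\big)(0,p/2) & p=7+24k,\\ (-1)^{k+1}\big(\frac{\prod}{p}\big)(0,p/2) & p=11+24k.\end{cases}$$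
   Context: $\big(\frac{\cdot}{p}\big)$ is the Legendre symbol. -}

module Defs where

open import Data.Bool using (Bool; true; false; if_then_else_; not; _∧_; _∨_)
open import Data.Nat using (ℕ; _*_; _<ᵇ_; suc)
open import Data.Nat.Divisibility using (_∣?_)
open import Data.Integer as ℤ using (ℤ; +_; -_)
open import Data.List using (List; upTo; filterᵇ; map; foldr; length)
open import Data.Bool.ListAction using (any)
open import Relation.Nullary.Decidable using (does)

divB : ℕ → ℕ → Bool
divB p x = does (p ∣? x)

-- x is a square modulo p: some y with 0 ≤ y < p has p ∣ (y² - x)
-- (every residue class mod p has a representative in [0,p))
isSqModB : ℕ → ℕ → Bool
isSqModB p x = any (λ y → does (p ∣? ℤ.∣ + (y * y) ℤ.- + x ∣)) (upTo p)

legendre : ℕ → ℕ → ℤ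
legendre p x =
  if divB p x then + 0 else (if isSqModB p x then + 1 else - (+ 1))

isNonResB : ℕ → ℕ → Bool
isNonResB p x = not (divB p x) ∧ not (isSqModB p x)

inIntB : ℕ → ℕ → ℕ → ℕ → ℕ → ℕ → Bool
inIntB p n₁ d₁ n₂ d₂ x = (n₁ * p <ᵇ d₁ * x) ∧ (d₂ * x <ᵇ n₂ * p)

-- (∏/p)(n₁ p / d₁ , n₂ p / d₂) = ∏_{x ∈ ℤ, n₁p/d₁ < x < n₂p/d₂} (x/p),
-- for nonnegative endpoints and d₂ ≥ 1; every such integer x satisfies
-- 0 ≤ x ≤ n₂ p, so enumerating x ∈ [0, n₂ p] is exhaustive.
prodLeg : ℕ → ℕ → ℕ → ℕ → ℕ → ℤ
prodLeg p n₁ d₁ n₂ d₂ =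
  foldr ℤ._*_ (+ 1)
    (map (legendre p) (filterᵇ (inIntB p n₁ d₁ n₂ d₂) (upTo (suc (n₂ * p)))))

inUnion6B : ℕ → ℕ → Bool
inUnion6B p x = inIntB p 1 12 1 6 x ∨ inIntB p 1 4 1 3 x ∨ inIntB p 5 12 1 2 x

-- #N_p(6): number of quadratic non-residues mod p among the integers in the union
-- (all such integers lie in [0, p))
numN6 : ℕ → ℕ
numN6 p = length (filterᵇ (λ x → inUnion6B p x ∧ isNonResB p x) (upTo p))

sgn : ℕ → ℤ
sgn n = (- (+ 1)) ℤ.^ n

{-# OPTIONS --safe #-}

-- Cut (0, p) into the twelve cells (ip/12, (i+1)p/12) and let sᵢ be the sum of
-- the Legendre symbol χ over cell i. If m ∈ {2, 3}, d = 12/m, and y is the residue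
-- of mx, then ⌊cell(y)/m⌋ = cell(x) mod d. Reindexing a sum by x ↦ mx therefore
-- gives the distribution relations Σ_{⌊i/m⌋ = j} sᵢ = χ(m) Σ_{i ≡ j mod d} sᵢ,
-- and x ↦ -x gives s₁₁₋ᵢ = χ(-1) sᵢ. As sᵢ is the size of cell i minus twice its
-- number of non-residues, each assertion is a congruence modulo 4 between the sᵢ,
-- and it follows from these linear relations (and Σ sᵢ = 0 when p ≡ 1 mod 24).
-- For p ≡ 3 (mod 4) the values χ(2) and χ(3) are themselves forced by the parities
-- of the cell sizes; for p ≡ 1 (mod 24) they come from the same reindexing applied
-- to products instead of sums (Gauss's lemma). Multiplicativity of χ is Euler's
-- criterion, proved by pairing x with a/x in the product of all units.
module Submission where

open import Algebra.Bundles using (CommutativeMonoid)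
open import Data.Bool using (Bool; true; false; if_then_else_; T; not; _∧_; _∨_)
import Data.Bool.Properties as Bool
open import Data.Fin.Base using (Fin; toℕ; fromℕ<)
open import Data.Fin.Permutation using (Permutation; permutation)
import Data.Fin.Properties as Fin
open import Data.List using (List; []; _∷_; upTo; applyUpTo; filterᵇ; length; map; foldr)
open import Data.Nat using (ℕ; zero; suc; _<_; z<s; s<s; s<s⁻¹; _≡ᵇ_)
import Data.Nat.Properties as ℕ
open import Data.Nat.Properties using (_<?_; _≟_; <-cmp)
open import Function using (_∘_; id; Equivalence)
open import Level using (0ℓ)
open import Relation.Binary.Definitions using (DecidableEquality; tri<; tri≈; tri>)
open import Relation.Binary.PropositionalEquality as ≡ using (_≡_; _≢_)
open import Relation.Nullary using (¬_; Dec; yes; no; does; contradiction)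
open import Relation.Nullary.Decidable
  using (dec-true; dec-false; True; toWitness; _→-dec_; _⊎-dec_; ¬?)

-- Every endpoint in the theorem is a multiple of p/12, and both 2 and 3 divide 12; this is where
-- the number twelve comes from. Reflection leaves the six unknowns s₀, ..., s₅. Only the parity of
-- a count is wanted, so the sᵢ need not be determined: the goal multiplied by 4 (or 2) is an
-- integer combination of the relations, and its coefficients are a certificate for the ring solver.
-- For p = 1 + 24k every cell has even size, so parity cannot decide χ(2) and χ(3); this is the
-- obstacle that Gauss's lemma removes. In the assertion for p ≡ 1 (mod 4), both signs of χ(2) lead
-- to the same conclusion. Facts about cells concern only the numbers c < 12 and are decided by
-- evaluation. Integer sums, counts and products modulo p are instances of one fold over a
-- commutative monoid, so reindexing and pairing are proved once for all three.

module Sum (M : CommutativeMonoid 0ℓ 0ℓ) where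
  open CommutativeMonoid M
  open import Algebra.Properties.CommutativeMonoid.Sum M
    using (sum; sum-cong-≋; ∑-distrib-+; sum-permute; sum-replicate-zero)
  open import Relation.Binary.Reasoning.Setoid setoid

  ∑ : ℕ → (ℕ → Carrier) → Carrier
  ∑ n F = sum {n} (λ i → F (toℕ i))

  infixr 4 _⇒_
  -- A term switched off contributes the neutral element, so a fold over a subset remains a fold
  -- over the whole range and can be reindexed by a permutation of that range.
  _⇒_ : Bool → Carrier → Carrier
  b ⇒ x = if b then x else ε

  ∑-cong : ∀ n {F G : ℕ → Carrier} → (∀ x → x < n → F x ≈ G x) → ∑ n F ≈ ∑ n G
  ∑-cong n F≈G = sum-cong-≋ (λ i → F≈G (toℕ i) (Fin.toℕ<n i))

  ∑-∙ : ∀ n (F G : ℕ → Carrier) → ∑ n (λ x → F x ∙ G x) ≈ ∑ n F ∙ ∑ n G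
  ∑-∙ n F G = ∑-distrib-+ {n} (F ∘ toℕ) (G ∘ toℕ)

  ∑-ε : ∀ n → ∑ n (λ _ → ε) ≈ ε
  ∑-ε = sum-replicate-zero

  ∑-reindex : ∀ n (F : ℕ → Carrier) {f g : ℕ → ℕ} →
    (∀ x → x < n → f x < n) → (∀ x → x < n → g x < n) →
    (∀ x → x < n → g (f x) ≡ x) → (∀ x → x < n → f (g x) ≡ x) →
    ∑ n F ≈ ∑ n (F ∘ f)
  ∑-reindex n F {f} {g} f< g< gf fg = begin
    ∑ n F                    ≈⟨ sum-permute (F ∘ toℕ) π ⟩
    sum (λ i → F (toℕ (to i)))  ≈⟨ sum-cong-≋ (λ i → reflexive (≡.cong F (Fin.toℕ-fromℕ< (f< (toℕ i) (Fin.toℕ<n i))))) ⟩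
    ∑ n (F ∘ f)              ∎
    where
    to from : Fin n → Fin n
    to i = fromℕ< (f< (toℕ i) (Fin.toℕ<n i))
    from i = fromℕ< (g< (toℕ i) (Fin.toℕ<n i))
    π : Permutation n n
    π = permutation to from
      (λ i → Fin.toℕ-injective (≡.trans (Fin.toℕ-fromℕ< _)
        (≡.trans (≡.cong f (Fin.toℕ-fromℕ< _)) (fg (toℕ i) (Fin.toℕ<n i)))))
      (λ i → Fin.toℕ-injective (≡.trans (Fin.toℕ-fromℕ< _)
        (≡.trans (≡.cong g (Fin.toℕ-fromℕ< _)) (gf (toℕ i) (Fin.toℕ<n i)))))

  -- Reindexing by σ carries the terms with x > σ x onto those with x < σ x, so each two-element
  -- orbit is collected at its smaller member and only the fixed points remain.
  ∑-involution : ∀ n (F : ℕ → Carrier) {σ : ℕ → ℕ} →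
    (∀ x → x < n → σ x < n) → (∀ x → x < n → σ (σ x) ≡ x) →
    ∑ n F ≈ ∑ n (λ x → does (x <? σ x) ⇒ F x ∙ F (σ x))
          ∙ ∑ n (λ x → does (x ≟ σ x) ⇒ F x)
  ∑-involution n F {σ} σ< σσ = begin
    ∑ n F
      ≈⟨ ∑-cong n (λ x _ → trichotomy x) ⟩
    ∑ n (λ x → (up x ∙ down x) ∙ fixed x)
      ≈⟨ ∑-∙ n (λ x → up x ∙ down x) fixed ⟩
    ∑ n (λ x → up x ∙ down x) ∙ ∑ n fixed
      ≈⟨ ∙-congʳ (∑-∙ n up down) ⟩
    (∑ n up ∙ ∑ n down) ∙ ∑ n fixed
      ≈⟨ ∙-congʳ (∙-congˡ (∑-reindex n down σ< σ< σσ σσ)) ⟩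
    (∑ n up ∙ ∑ n (down ∘ σ)) ∙ ∑ n fixed
      ≈⟨ ∙-congʳ (∑-∙ n up (down ∘ σ)) ⟨
    ∑ n (λ x → up x ∙ down (σ x)) ∙ ∑ n fixed
      ≈⟨ ∙-congʳ (∑-cong n paired) ⟩
    ∑ n (λ x → does (x <? σ x) ⇒ F x ∙ F (σ x)) ∙ ∑ n fixed ∎
    where
    up down fixed : ℕ → Carrier
    up x = does (x <? σ x) ⇒ F x
    down x = does (σ x <? x) ⇒ F x
    fixed x = does (x ≟ σ x) ⇒ F x
    trichotomy : ∀ x → F x ≈ (up x ∙ down x) ∙ fixed x
    trichotomy x with <-cmp x (σ x)
    ... | tri< a b c rewrite dec-true (x <? σ x) a | dec-false (x ≟ σ x) b | dec-false (σ x <? x) c =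
      sym (trans (identityʳ _) (identityʳ _))
    ... | tri≈ a b c rewrite dec-false (x <? σ x) a | dec-true (x ≟ σ x) b | dec-false (σ x <? x) c =
      sym (trans (∙-congʳ (identityʳ _)) (identityˡ _))
    ... | tri> a b c rewrite dec-false (x <? σ x) a | dec-false (x ≟ σ x) b | dec-true (σ x <? x) c =
      sym (trans (identityʳ _) (identityˡ _))
    paired : ∀ x → x < n → up x ∙ down (σ x) ≈ (does (x <? σ x) ⇒ F x ∙ F (σ x))
    paired x x<n rewrite σσ x x<n with does (x <? σ x)
    ... | true  = refl
    ... | false = identityʳ ε

  ∑-delta : ∀ n c (v : Carrier) → c < n → ∑ n (λ x → (x ≡ᵇ c) ⇒ v) ≈ v
  ∑-delta (suc n) zero    v _   = trans (∙-congˡ (∑-ε n)) (identityʳ v)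
  ∑-delta (suc n) (suc c) v c<n = trans (identityˡ _) (∑-delta n c v (s<s⁻¹ c<n))

open import Relation.Binary.PropositionalEquality hiding (setoid; _≡_; _≢_)

-- Linear relations between cell sums, with explicit certificates.

module LinearRelations where
  open import Data.Integer
  open import Data.Integer.Properties
  open import Data.Integer.Tactic.RingSolver

  -- One step of a certificate: the hypothesis is spent with coefficient c. Once all are spent, what
  -- remains is a polynomial identity for `solve`.
  add-multiple : ∀ c {l r x y} → l ≡ r → x ≡ y + c * (l - r) → x ≡ y
  add-multiple c {l} {r} {x} {y} l≡r eq = trans eq (trans (cong (λ t → y + c * t) (i≡j⇒i-j≡0 l≡r))
    (trans (cong (λ t → y + t) (*-zeroʳ c)) (+-identityʳ y)))

  -- In case r, p = r + 24k, the number of non-residues in cells 1, 3, 5 is n (or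
  -- n₁ + n₃ + n₅), and m is the number of those in (0, p/2). The trailing 0ℤ's give
  -- the hypotheses the shape of cellSums on a list of cells.
  case7 : ∀ {s₀ s₁ s₂ s₃ s₄ s₅ k n m} →
    s₂ + s₃ ≡ 1ℤ * (s₁ + -1ℤ * s₄) → s₀ + s₁ + s₂ ≡ -1ℤ * (s₀ + s₄ + -1ℤ * s₃) →
    s₁ + (s₃ + (s₅ + 0ℤ)) ≡ (+ 3 + + 3 * (+ 2 * k)) - + 2 * n →
    s₀ + (s₁ + (s₂ + (s₃ + (s₄ + (s₅ + 0ℤ))))) ≡ (+ 3 + + 6 * (+ 2 * k)) - + 2 * m →
    n ≡ (k + m) + + 2 * (- (+ 2 * k))
  case7 {s₀} {s₁} {s₂} {s₃} {s₄} {s₅} {k} {n} {m} e₁ e₂ e₃ e₄ = *-cancelˡ-≡ (+ 4) _ _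
    (add-multiple (+ 1) e₁ (add-multiple (+ 1) e₂ (add-multiple (+ 2) e₃ (add-multiple (- + 2) e₄
      (solve (s₀ ∷ s₁ ∷ s₂ ∷ s₃ ∷ s₄ ∷ s₅ ∷ k ∷ n ∷ m ∷ []))))))

  case11 : ∀ {s₀ s₁ s₂ s₃ s₄ s₅ k n m} →
    s₀ + s₁ ≡ -1ℤ * (s₀ + -1ℤ * s₅) → s₄ + s₅ ≡ -1ℤ * (s₂ + -1ℤ * s₃) →
    s₃ + s₄ + s₅ ≡ 1ℤ * (s₁ + s₅ + -1ℤ * s₂) →
    s₁ + (s₃ + (s₅ + 0ℤ)) ≡ (+ 3 + + 3 * (+ 2 * k)) - + 2 * n →
    s₀ + (s₁ + (s₂ + (s₃ + (s₄ + (s₅ + 0ℤ))))) ≡ (+ 5 + + 6 * (+ 2 * k)) - + 2 * m →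
    n ≡ (k + 1ℤ + m) + + 2 * (- (+ 1 + + 2 * k))
  case11 {s₀} {s₁} {s₂} {s₃} {s₄} {s₅} {k} {n} {m} e₁ e₂ e₃ e₄ e₅ = *-cancelˡ-≡ (+ 4) _ _
    (add-multiple (+ 1) e₁ (add-multiple (+ 1) e₂ (add-multiple (+ 1) e₃ (add-multiple (+ 2) e₄ (add-multiple (- + 2) e₅
      (solve (s₀ ∷ s₁ ∷ s₂ ∷ s₃ ∷ s₄ ∷ s₅ ∷ k ∷ n ∷ m ∷ [])))))))

  case19 : ∀ {s₁ s₂ s₃ s₄ s₅ k n} →
    s₂ + s₃ ≡ -1ℤ * (s₁ + -1ℤ * s₄) → s₃ + s₄ + s₅ ≡ -1ℤ * (s₁ + s₅ + -1ℤ * s₂) →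
    s₁ + (s₃ + (s₅ + 0ℤ)) ≡ (+ 6 + + 3 * (+ 2 * k)) - + 2 * n →
    n ≡ (k + 1ℤ) + + 2 * (+ 1 + k)
  case19 {s₁} {s₂} {s₃} {s₄} {s₅} {k} {n} e₁ e₂ e₃ = *-cancelˡ-≡ (+ 4) _ _
    (add-multiple (- + 1) e₁ (add-multiple (- + 1) e₂ (add-multiple (+ 2) e₃
      (solve (s₁ ∷ s₂ ∷ s₃ ∷ s₄ ∷ s₅ ∷ k ∷ n ∷ [])))))

  case23 : ∀ {s₀ s₁ s₂ s₃ s₄ s₅ k n} →
    s₀ + s₁ ≡ 1ℤ * (s₀ + -1ℤ * s₅) → s₄ + s₅ ≡ 1ℤ * (s₂ + -1ℤ * s₃) →
    s₀ + s₁ + s₂ ≡ 1ℤ * (s₀ + s₄ + -1ℤ * s₃) →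
    s₁ + (s₃ + (s₅ + 0ℤ)) ≡ (+ 6 + + 3 * (+ 2 * k)) - + 2 * n →
    n ≡ (k + 1ℤ) + + 2 * (+ 1 + k)
  case23 {s₀} {s₁} {s₂} {s₃} {s₄} {s₅} {k} {n} e₁ e₂ e₃ e₄ = *-cancelˡ-≡ (+ 4) _ _
    (add-multiple (- + 1) e₁ (add-multiple (- + 1) e₂ (add-multiple (- + 1) e₃ (add-multiple (+ 2) e₄
      (solve (s₀ ∷ s₁ ∷ s₂ ∷ s₃ ∷ s₄ ∷ s₅ ∷ k ∷ n ∷ []))))))

  -- In the sum of the three doubling relations the cells 3, 4, 5 cancel, so χ sums to zero over (0,
  -- p/4). This lemma and the next three exhibit, for each value of χ(2) or χ(3), a region of
  -- vanishing sum; a region with an odd number of units then refutes that value.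
  χ2≡-1⇒ : ∀ {s₀ s₁ s₂ s₃ s₄ s₅} →
    s₀ + s₁ ≡ -1ℤ * (s₀ + -1ℤ * s₅) → s₂ + s₃ ≡ -1ℤ * (s₁ + -1ℤ * s₄) →
    s₄ + s₅ ≡ -1ℤ * (s₂ + -1ℤ * s₃) → s₀ + (s₁ + (s₂ + 0ℤ)) ≡ 0ℤ
  χ2≡-1⇒ {s₀} {s₁} {s₂} {s₃} {s₄} {s₅} e₁ e₂ e₃ = *-cancelˡ-≡ (+ 2) _ _
    (add-multiple (+ 1) e₁ (add-multiple (+ 1) e₂ (add-multiple (+ 1) e₃ (solve (s₀ ∷ s₁ ∷ s₂ ∷ s₃ ∷ s₄ ∷ s₅ ∷ [])))))

  χ2≡1⇒ : ∀ {s₀ s₁ s₂ s₃ s₄ s₅} →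
    s₀ + s₁ ≡ 1ℤ * (s₀ + -1ℤ * s₅) → s₂ + s₃ ≡ 1ℤ * (s₁ + -1ℤ * s₄) →
    s₄ + s₅ ≡ 1ℤ * (s₂ + -1ℤ * s₃) → s₃ + (s₄ + (s₅ + 0ℤ)) ≡ 0ℤ
  χ2≡1⇒ {s₀} {s₁} {s₂} {s₃} {s₄} {s₅} e₁ e₂ e₃ = *-cancelˡ-≡ (+ 2) _ _
    (add-multiple (+ 1) e₁ (add-multiple (+ 1) e₂ (add-multiple (+ 1) e₃ (solve (s₀ ∷ s₁ ∷ s₂ ∷ s₃ ∷ s₄ ∷ s₅ ∷ [])))))

  χ3≡-1⇒ : ∀ {s₀ s₁ s₂ s₃ s₄ s₅} →
    s₀ + s₁ + s₂ ≡ -1ℤ * (s₀ + s₄ + -1ℤ * s₃) → s₃ + s₄ + s₅ ≡ -1ℤ * (s₁ + s₅ + -1ℤ * s₂) →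
    s₀ + (s₁ + (s₄ + (s₅ + 0ℤ))) ≡ 0ℤ
  χ3≡-1⇒ {s₀} {s₁} {s₂} {s₃} {s₄} {s₅} e₁ e₂ = *-cancelˡ-≡ (+ 2) _ _
    (add-multiple (+ 1) e₁ (add-multiple (+ 1) e₂ (solve (s₀ ∷ s₁ ∷ s₂ ∷ s₃ ∷ s₄ ∷ s₅ ∷ []))))

  χ3≡1⇒ : ∀ {s₀ s₁ s₂ s₃ s₄ s₅} →
    s₀ + s₁ + s₂ ≡ 1ℤ * (s₀ + s₄ + -1ℤ * s₃) → s₃ + s₄ + s₅ ≡ 1ℤ * (s₁ + s₅ + -1ℤ * s₂) →
    s₂ + (s₃ + 0ℤ) ≡ 0ℤ
  χ3≡1⇒ {s₀} {s₁} {s₂} {s₃} {s₄} {s₅} e₁ e₂ = *-cancelˡ-≡ (+ 2) _ _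
    (add-multiple (+ 1) e₁ (add-multiple (+ 1) e₂ (solve (s₀ ∷ s₁ ∷ s₂ ∷ s₃ ∷ s₄ ∷ s₅ ∷ []))))


  -- The doubling relation reduces to s₁ + s₅ = 0: residues and non-residues balance in cells 1 and
  -- 5 together, so n₁ + n₅ is half their joint size, d + 2k.
  odd-χ2≡1 : ∀ {s₀ s₁ s₅ k d n₁ n₃ n₅} →
    s₀ + s₁ ≡ 1ℤ * (s₀ + -1ℤ * s₅) →
    s₁ + (s₅ + 0ℤ) ≡ ((+ 2 * d) + + 2 * (+ 2 * k)) - + 2 * (n₁ + (n₅ + 0ℤ)) →
    n₁ + (n₃ + (n₅ + 0ℤ)) ≡ (d + (n₃ + 0ℤ)) + + 2 * k
  odd-χ2≡1 {s₀} {s₁} {s₅} {k} {d} {n₁} {n₃} {n₅} e₁ e₂ = *-cancelˡ-≡ (+ 2) _ _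
    (add-multiple (- + 1) e₁ (add-multiple (+ 1) e₂ (solve (s₀ ∷ s₁ ∷ s₅ ∷ k ∷ d ∷ n₁ ∷ n₃ ∷ n₅ ∷ []))))

  module _ {s₀ s₁ s₅ k d₀ d₁ n₀ n₁ n₃ n₅ : ℤ}
    (c₀ : s₀ + 0ℤ ≡ (d₀ + + 1 * (+ 2 * k)) - + 2 * (n₀ + 0ℤ))
    (c₁ : s₁ + 0ℤ ≡ (d₁ + + 1 * (+ 2 * k)) - + 2 * (n₁ + 0ℤ))
    (c₅ : s₅ + 0ℤ ≡ (d₁ + + 1 * (+ 2 * k)) - + 2 * (n₅ + 0ℤ)) where

    -- Now 2s₀ + s₁ = s₅. The equal sizes of cells 1 and 5 cancel, which leaves n₁ - n₅ = d₀ + 2k -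
    -- 2n₀, so n₁ + n₅ has the parity of d₀.
    odd-χ2≡-1 : s₀ + s₁ ≡ -1ℤ * (s₀ + -1ℤ * s₅) →
      n₁ + (n₃ + (n₅ + 0ℤ)) ≡ (d₀ + (n₃ + 0ℤ)) + + 2 * (n₅ + k - n₀)
    odd-χ2≡-1 e = *-cancelˡ-≡ (+ 2) _ _
      (add-multiple (- + 1) e (add-multiple (+ 2) c₀ (add-multiple (+ 1) c₁ (add-multiple (- + 1) c₅
        (solve (s₀ ∷ s₁ ∷ s₅ ∷ k ∷ d₀ ∷ d₁ ∷ n₀ ∷ n₁ ∷ n₃ ∷ n₅ ∷ []))))))

    -- Here s₁ = s₅ for cells of equal size, hence n₁ = n₅.
    even-χ2≡1 : s₀ + s₁ ≡ 1ℤ * (s₀ + 1ℤ * s₅) →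
      n₁ + (n₃ + (n₅ + 0ℤ)) ≡ (n₃ + 0ℤ) + + 2 * n₁
    even-χ2≡1 e = *-cancelˡ-≡ (+ 2) _ _
      (add-multiple (+ 1) e (add-multiple (- + 1) c₁ (add-multiple (+ 1) c₅
        (solve (s₀ ∷ s₁ ∷ s₅ ∷ k ∷ d₁ ∷ n₁ ∷ n₃ ∷ n₅ ∷ [])))))

    -- Here 2s₀ + s₁ + s₅ = 0 for three cells of equal size, which makes n₁ + n₅ twice d₀ + 2k - n₀.
    even-χ2≡-1 : d₀ ≡ d₁ → s₀ + s₁ ≡ -1ℤ * (s₀ + 1ℤ * s₅) →
      n₁ + (n₃ + (n₅ + 0ℤ)) ≡ (n₃ + 0ℤ) + + 2 * (d₀ + + 2 * k - n₀)
    even-χ2≡-1 f e = *-cancelˡ-≡ (+ 2) _ _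
      (add-multiple (- + 1) e (add-multiple (+ 2) c₀ (add-multiple (+ 1) c₁ (add-multiple (+ 1) c₅ (add-multiple (- + 2) f
        (solve (s₀ ∷ s₁ ∷ s₅ ∷ k ∷ d₀ ∷ d₁ ∷ n₀ ∷ n₁ ∷ n₃ ∷ n₅ ∷ [])))))))

  -- The first two relations give s₂ = s₄ and s₁ = s₃, so the vanishing half sum becomes s₀ + (s₁ +
  -- s₃ + s₅) + 2s₂ = 0. In terms of counts, n₀ + (n₁ + n₃ + n₅) + 2n₂ = 6k.
  case1 : ∀ {s₀ s₁ s₂ s₃ s₄ s₅ k n₀ n₁ n₂ n₃ n₅} →
    s₂ + s₃ ≡ 1ℤ * (s₁ + 1ℤ * s₄) → s₀ + s₁ + s₂ ≡ 1ℤ * (s₀ + s₄ + 1ℤ * s₃) →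
    s₀ + s₁ + s₂ + s₃ + s₄ + s₅ ≡ 0ℤ →
    s₀ + 0ℤ ≡ (+ 0 + + 1 * (+ 2 * k)) - + 2 * (n₀ + 0ℤ) →
    s₁ + (s₃ + (s₅ + 0ℤ)) ≡ (+ 0 + + 3 * (+ 2 * k)) - + 2 * (n₁ + (n₃ + (n₅ + 0ℤ))) →
    s₂ + 0ℤ ≡ (+ 0 + + 1 * (+ 2 * k)) - + 2 * (n₂ + 0ℤ) →
    n₁ + (n₃ + (n₅ + 0ℤ)) ≡ (n₀ + 0ℤ) + + 2 * ((n₁ + (n₃ + (n₅ + 0ℤ))) + n₂ - + 3 * k)
  case1 {s₀} {s₁} {s₂} {s₃} {s₄} {s₅} {k} {n₀} {n₁} {n₂} {n₃} {n₅} e₂ e₃ e₄ c₀ c c₂ = *-cancelˡ-≡ (+ 4) _ _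
    (add-multiple (+ 1) e₂ (add-multiple (+ 1) e₃ (add-multiple (+ 2) e₄
      (add-multiple (- + 2) c₀ (add-multiple (- + 2) c (add-multiple (- + 4) c₂
        (solve (s₀ ∷ s₁ ∷ s₂ ∷ s₃ ∷ s₄ ∷ s₅ ∷ k ∷ n₀ ∷ n₁ ∷ n₂ ∷ n₃ ∷ n₅ ∷ []))))))))

open LinearRelations

open import Data.Integer as ℤ using (ℤ; +_; -_; -[1+_]; -1ℤ; 0ℤ; 1ℤ) renaming (_*_ to _*ℤ_)
import Data.Integer.Properties as ℤ
import Data.Integer.Tactic.RingSolver as ℤ-Solver
open import Data.List.Membership.Propositional using (lose; find)
open import Data.List.Membership.Propositional.Properties using (∈-upTo⁺)
open import Data.List.Relation.Unary.All as All using (All; all?)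
open import Data.List.Relation.Unary.Any.Properties using (any⁺; any⁻)
open import Data.Nat
open import Data.Nat.Coprimality using (prime⇒coprime; coprime-Bézout)
open import Data.Nat.Divisibility
open import Data.Nat.DivMod
open import Data.Nat.GCD using (module Bézout)
import Data.Nat.ListAction as List
open import Data.Nat.Primality using (Prime; prime⇒nonZero; prime⇒irreducible; euclidsLemma)
open import Data.Nat.Properties
open import Data.Nat.Tactic.RingSolver using (solve-∀)
open import Data.Product using (∃; _,_; proj₁; proj₂; _×_)
open import Data.Sum using (_⊎_; inj₁; inj₂)
open import Defs

open Sum ℕ.+-0-commutativeMonoid using ()
  renaming (∑ to ∑ℕ; _⇒_ to _⇒ℕ_; ∑-cong to ∑ℕ-cong; ∑-∙ to ∑ℕ-+; ∑-reindex to ∑ℕ-reindex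
           ; ∑-involution to ∑ℕ-involution; ∑-delta to ∑ℕ-delta)

open Sum ℤ.+-0-commutativeMonoid using ()
  renaming (∑ to ∑ℤ; _⇒_ to _⇒ℤ_; ∑-cong to ∑ℤ-cong; ∑-∙ to ∑ℤ-+; ∑-ε to ∑ℤ-0; ∑-reindex to ∑ℤ-reindex)

-- Counts, weights on cells, and signs.

count : ℕ → (ℕ → Bool) → ℕ
count n b = ∑ℕ n (λ x → b x ⇒ℕ 1)

∑ℤ-* : ∀ n a (F : ℕ → ℤ) → ∑ℤ n (λ x → a ℤ.* F x) ≡ a ℤ.* ∑ℤ n F
∑ℤ-* zero    a F = sym (ℤ.*-zeroʳ a)
∑ℤ-* (suc n) a F = trans (cong (λ t → a ℤ.* F 0 ℤ.+ t) (∑ℤ-* n a (F ∘ suc))) (sym (ℤ.*-distribˡ-+ a (F 0) _))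

∑ℤ-pos : ∀ n (F : ℕ → ℕ) → ∑ℤ n (λ x → + F x) ≡ + ∑ℕ n F
∑ℤ-pos zero    F = refl
∑ℤ-pos (suc n) F = trans (cong (λ t → + F 0 ℤ.+ t) (∑ℤ-pos n (F ∘ suc))) (sym (ℤ.pos-+ (F 0) _))

indicator : Bool → ℤ
indicator b = b ⇒ℤ 1ℤ

-- The common form in which a set of cells given by a predicate and one given by a list are
-- compared: an integer weight on c.
multiplicity : List ℕ → ℕ → ℤ
multiplicity []      c = 0ℤ
multiplicity (i ∷ L) c = indicator (c ≡ᵇ i) ℤ.+ multiplicity L c

-- Occurs as an implicit `True` argument: for concrete functions the check over the twelve cells
-- evaluates, and the argument is filled in automatically.
agree-below-12? : ∀ {A : Set} → DecidableEquality A → (f g : ℕ → A) →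
  Dec (∀ {c} → c < 12 → f c ≡ g c)
agree-below-12? _≟_ f g = allUpTo? (λ c → f c ≟ g c) 12

length-filter : ∀ b (f : ℕ → ℕ) n → length (filterᵇ b (applyUpTo f n)) ≡ count n (b ∘ f)
length-filter b f zero    = refl
length-filter b f (suc n) with b (f 0)
... | true  = cong suc (length-filter b (f ∘ suc) n)
... | false = length-filter b (f ∘ suc) n

count-suc : ∀ n b → count (suc n) b ≡ count n b + (b n ⇒ℕ 1)
count-suc zero    b = +-comm (b 0 ⇒ℕ 1) 0
count-suc (suc n) b = trans (cong (λ t → (b 0 ⇒ℕ 1) + t) (count-suc n (b ∘ suc))) (sym (+-assoc (b 0 ⇒ℕ 1) _ _))

sgn-+ : ∀ a b → sgn (a + b) ≡ sgn a ℤ.* sgn b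
sgn-+ a b = ℤ.^-distribˡ-+-* (- (+ 1)) a b

sgn-even : ∀ m → sgn (m + m) ≡ 1ℤ
sgn-even zero    = refl
sgn-even (suc m) = trans (cong sgn (cong suc (+-suc m m))) (trans (double (sgn (m + m))) (sgn-even m))
  where
  double : ∀ t → (- (+ 1)) ℤ.* ((- (+ 1)) ℤ.* t) ≡ t
  double = ℤ-Solver.solve-∀

-- The exit from linear algebra over ℤ to signs. The quotient z may be negative; then the relation
-- is turned around, so that b exceeds a by an even natural number.
sgn-mod2 : ∀ {a b} z → + a ≡ + b ℤ.+ + 2 ℤ.* z → sgn a ≡ sgn b
sgn-mod2 {a} {b} (+ m) e = trans (cong sgn (ℤ.+-injective (trans e (cong (λ t → + b ℤ.+ t)
    (trans (sym (ℤ.pos-* 2 m)) (cong (λ t → + (m + t)) (+-identityʳ m)))))))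
  (trans (sgn-+ b (m + m)) (trans (cong (sgn b ℤ.*_) (sgn-even m)) (ℤ.*-identityʳ (sgn b))))
sgn-mod2 {a} {b} -[1+ m ] e = sym (trans (cong sgn (ℤ.+-injective {b} {a + (suc m + suc m)} (begin
    + b                                          ≡⟨ cancel (+ b) (+ suc m) ⟨
    (+ b ℤ.+ + 2 ℤ.* -[1+ m ]) ℤ.+ (+ suc m ℤ.+ + suc m)  ≡⟨ cong (λ t → t ℤ.+ (+ suc m ℤ.+ + suc m)) e ⟨
    + a ℤ.+ (+ suc m ℤ.+ + suc m)                ≡⟨⟩
    + (a + (suc m + suc m))                      ∎)))
  (trans (sgn-+ a (suc m + suc m)) (trans (cong (sgn a ℤ.*_) (sgn-even (suc m))) (ℤ.*-identityʳ (sgn a)))))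
  where
  open ≡-Reasoning
  cancel : ∀ b m → (b ℤ.+ + 2 ℤ.* (ℤ.- m)) ℤ.+ (m ℤ.+ m) ≡ b
  cancel = ℤ-Solver.solve-∀

odd≢even : ∀ m {z} → + suc (2 * m) ≢ + 2 ℤ.* z
odd≢even m {z} e = contradiction (sgn-mod2 {suc (2 * m)} {0} z (trans e (sym (ℤ.+-identityˡ _))))
  (λ s → contradiction (trans (sym s) (cong (λ t → (- (+ 1)) ℤ.* t) (trans (cong (λ t → sgn (m + t)) (+-identityʳ m)) (sgn-even m)))) λ ())

module Proof (p : ℕ) (prime : Prime p) (10<p : 10 < p) where
  2<p : 2 < p
  2<p = ≤-trans (m≤m+n 3 8) 10<p

  -- Arithmetic modulo p: units, inverses, Fermat's little theorem.

  module Residues where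
    instance
      p≢0 : NonZero p
      p≢0 = prime⇒nonZero prime

    0%p≡0 : 0 % p ≡ 0
    0%p≡0 = m*n%n≡0 0 p

    infix 4 _≈_
    _≈_ : ℕ → ℕ → Set
    x ≈ y = x % p ≡ y % p

    -- The representative of -1; residues are kept as natural numbers throughout.
    neg : ℕ
    neg = p ∸ 1

    p≡1+neg : p ≡ suc neg
    p≡1+neg = sym (m+[n∸m]≡n (<-trans (s≤s z≤n) 2<p))

    neg<p : neg < p
    neg<p = subst (neg <_) (sym p≡1+neg) ≤-refl

    1<p : 1 < p
    1<p = <-trans (s≤s (s≤s z≤n)) 2<p

    %-≈ : ∀ x → x % p ≈ x
    %-≈ x = m%n%n≡m%n x p

    ≈⇒≡ : ∀ {x y} → x < p → y < p → x ≈ y → x ≡ y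
    ≈⇒≡ x<p y<p e = trans (sym (m<n⇒m%n≡m x<p)) (trans e (m<n⇒m%n≡m y<p))

    *-cong-≈ : ∀ {x y u v} → x ≈ y → u ≈ v → x * u ≈ y * v
    *-cong-≈ {x} {y} {u} {v} e f = begin
      (x * u) % p              ≡⟨ %-distribˡ-* x u p ⟩
      ((x % p) * (u % p)) % p  ≡⟨ cong₂ (λ s t → (s * t) % p) e f ⟩
      ((y % p) * (v % p)) % p  ≡⟨ %-distribˡ-* y v p ⟨
      (y * v) % p              ∎
      where open ≡-Reasoning

    +-cong-≈ : ∀ {x y u v} → x ≈ y → u ≈ v → x + u ≈ y + v
    +-cong-≈ {x} {y} {u} {v} e f = begin
      (x + u) % p              ≡⟨ %-distribˡ-+ x u p ⟩
      ((x % p) + (u % p)) % p  ≡⟨ cong₂ (λ s t → (s + t) % p) e f ⟩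
      ((y % p) + (v % p)) % p  ≡⟨ %-distribˡ-+ y v p ⟨
      (y + v) % p              ∎
      where open ≡-Reasoning

    *-congˡ-≈ : ∀ z {x y} → x ≈ y → z * x ≈ z * y
    *-congˡ-≈ z = *-cong-≈ {z} {z} refl

    *-congʳ-≈ : ∀ z {x y} → x ≈ y → x * z ≈ y * z
    *-congʳ-≈ z e = *-cong-≈ {u = z} {z} e refl

    -- Taking congruence as the equality turns the generic folds into products of residues modulo p.
    *-commutativeMonoid-≈ : CommutativeMonoid 0ℓ 0ℓ
    *-commutativeMonoid-≈ = record
      { Carrier = ℕ ; _≈_ = _≈_ ; _∙_ = _*_ ; ε = 1
      ; isCommutativeMonoid = record
        { isMonoid = record
          { isSemigroup = record
            { isMagma = record
              { isEquivalence = record { refl = refl ; sym = sym ; trans = trans }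
              ; ∙-cong = λ {x} {y} {u} {v} → *-cong-≈ {x} {y} {u} {v} }
            ; assoc = λ x y z → cong (_% p) (*-assoc x y z) }
          ; identity = (λ x → cong (_% p) (*-identityˡ x)) , (λ x → cong (_% p) (*-identityʳ x)) }
        ; comm = λ x y → cong (_% p) (*-comm x y) } }

    open CommutativeMonoid *-commutativeMonoid-≈ using (setoid)
    open import Relation.Binary.Reasoning.Setoid setoid
    open Sum *-commutativeMonoid-≈ public
      renaming (∑ to ∏; ∑-cong to ∏-cong; ∑-∙ to ∏-*; ∑-ε to ∏-1; ∑-reindex to ∏-reindex
               ; ∑-involution to ∏-involution; ∑-delta to ∏-delta)

    Unit : ℕ → Set
    Unit x = x % p ≢ 0

    ≢0⇒Unit : ∀ {x} → x < p → x ≢ 0 → Unit x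
    ≢0⇒Unit x<p x≢0 = x≢0 ∘ trans (sym (m<n⇒m%n≡m x<p))

    Unit-1 : Unit 1
    Unit-1 = ≢0⇒Unit 1<p (λ ())

    Unit-* : ∀ {x y} → Unit x → Unit y → Unit (x * y)
    Unit-* {x} {y} ux uy e with euclidsLemma x y prime (m%n≡0⇒n∣m (x * y) p e)
    ... | inj₁ d = ux (n∣m⇒m%n≡0 x p d)
    ... | inj₂ d = uy (n∣m⇒m%n≡0 y p d)

    Unit-*ˡ : ∀ {x y} → Unit (x * y) → Unit x
    Unit-*ˡ {x} {y} u e = u (trans (*-congʳ-≈ y {x} {0} (trans e (sym 0%p≡0))) 0%p≡0)

    Unit-*ʳ : ∀ {x y} → Unit (x * y) → Unit y
    Unit-*ʳ {x} {y} u = Unit-*ˡ {y} {x} (u ∘ trans (cong (_% p) (*-comm x y)))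

    Unit-≈ : ∀ {x y} → x ≈ y → Unit x → Unit y
    Unit-≈ e u = u ∘ trans e

    Unit-^ : ∀ {x} n → Unit x → Unit (x ^ n)
    Unit-^ zero    u = Unit-1
    Unit-^ {x} (suc n) u = Unit-* {x} u (Unit-^ n u)

    neg*neg≈1 : neg * neg ≈ 1
    neg*neg≈1 = begin
      neg * neg            ≡⟨ cong (λ q → (q ∸ 1) * (q ∸ 1)) p≡2+r ⟩
      (1 + r) * (1 + r)    ≡⟨ expand r ⟩
      1 + r * (2 + r)      ≡⟨ cong (λ q → 1 + r * q) p≡2+r ⟨
      1 + r * p            ≈⟨ [m+kn]%n≡m%n 1 r p ⟩
      1                    ∎
      where
      r = p ∸ 2
      p≡2+r : p ≡ 2 + r
      p≡2+r = sym (m+[n∸m]≡n (<⇒≤ 2<p))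
      expand : ∀ r → (1 + r) * (1 + r) ≡ 1 + r * (2 + r)
      expand = solve-∀

    1≉neg : ¬ (1 ≈ neg)
    1≉neg e = <⇒≢ 2<p (trans (cong suc (≈⇒≡ 1<p neg<p e)) (sym p≡1+neg))

    1+x≈0⇒x≈neg : ∀ {x} → 1 + x ≈ 0 → x ≈ neg
    1+x≈0⇒x≈neg {x} e = begin
      x                  ≈⟨ [m+n]%n≡m%n x p ⟨
      x + p              ≡⟨ cong (λ t → x + t) p≡1+neg ⟩
      x + (1 + neg)      ≡⟨ +-suc x neg ⟩
      1 + x + neg        ≈⟨ +-cong-≈ {1 + x} {0} {neg} {neg} e refl ⟩
      neg                ∎

    inverse : ∀ x → Unit x → ∃ λ y → x * y ≈ 1
    inverse x u with coprime-Bézout (prime⇒coprime prime {{≢-nonZero u}} (m%n<n x p))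
    ... | Bézout.-+ a b eq = b , (begin
      x * b          ≈⟨ *-congʳ-≈ b (%-≈ x) ⟨
      x % p * b      ≡⟨ *-comm (x % p) b ⟩
      b * (x % p)    ≡⟨ eq ⟨
      1 + a * p      ≈⟨ [m+kn]%n≡m%n 1 a p ⟩
      1              ∎)
    -- This Bézout identity reads 1 + b x = a p, so b is the inverse of x up to sign and a factor -1
    -- corrects it.
    ... | Bézout.+- a b eq = b * neg , (begin
      x * (b * neg)        ≡⟨ *-assoc x b neg ⟨
      x * b * neg          ≈⟨ *-congʳ-≈ neg (*-congʳ-≈ b (%-≈ x)) ⟨
      x % p * b * neg      ≡⟨ cong (_* neg) (*-comm (x % p) b) ⟩
      b * (x % p) * neg    ≈⟨ *-congʳ-≈ neg (1+x≈0⇒x≈neg {b * (x % p)} (trans (cong (_% p) eq) (trans (m*n%n≡0 a p) (sym 0%p≡0)))) ⟩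
      neg * neg            ≈⟨ neg*neg≈1 ⟩
      1                    ∎)

    -- The default value 0 at non-units lets x ↦ a/x fix 0, and thus be an involution of all of [0,
    -- p).
    inv : ℕ → ℕ
    inv x with x % p ≟ 0
    ... | yes _ = 0
    ... | no u  = proj₁ (inverse x u)

    inv-0 : inv 0 ≡ 0
    inv-0 with 0 % p ≟ 0
    ... | yes _ = refl
    ... | no u  = contradiction (0%p≡0) u

    *-inverseʳ : ∀ x → Unit x → x * inv x ≈ 1
    *-inverseʳ x u with x % p ≟ 0
    ... | yes e = contradiction e u
    ... | no u′ = proj₂ (inverse x u′)

    *-inverse-assoc : ∀ x y → Unit x → inv x * (x * y) ≈ y
    *-inverse-assoc x y u = begin
      inv x * (x * y)  ≡⟨ *-assoc (inv x) x y ⟨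
      inv x * x * y    ≡⟨ cong (_* y) (*-comm (inv x) x) ⟩
      x * inv x * y    ≈⟨ *-congʳ-≈ y (*-inverseʳ x u) ⟩
      1 * y            ≡⟨ *-identityˡ y ⟩
      y                ∎

    *-inverse-assoc′ : ∀ x y → Unit x → x * (inv x * y) ≈ y
    *-inverse-assoc′ x y u = begin
      x * (inv x * y)  ≡⟨ *-assoc x (inv x) y ⟨
      x * inv x * y    ≈⟨ *-congʳ-≈ y (*-inverseʳ x u) ⟩
      1 * y            ≡⟨ *-identityˡ y ⟩
      y                ∎

    *-cancelˡ-≈ : ∀ x {y z} → Unit x → x * y ≈ x * z → y ≈ z
    *-cancelˡ-≈ x {y} {z} u e = begin
      y                ≈⟨ *-inverse-assoc x y u ⟨
      inv x * (x * y)  ≈⟨ *-congˡ-≈ (inv x) e ⟩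
      inv x * (x * z)  ≈⟨ *-inverse-assoc x z u ⟩
      z                ∎

    ^-cong-≈ : ∀ {x y} n → x ≈ y → x ^ n ≈ y ^ n
    ^-cong-≈ zero    e = refl
    ^-cong-≈ {x} {y} (suc n) e = *-cong-≈ {x} {y} e (^-cong-≈ n e)

    mul : ℕ → ℕ → ℕ
    mul m x = m * x % p

    module _ {m : ℕ} (u : Unit m) where
      mul< : ∀ k x → x < p → mul k x < p
      mul< k x _ = m%n<n (k * x) p

      mul-inverseˡ : ∀ x → x < p → mul (inv m) (mul m x) ≡ x
      mul-inverseˡ x x<p = trans
        (trans (*-congˡ-≈ (inv m) (%-≈ (m * x))) (*-inverse-assoc m x u)) (m<n⇒m%n≡m x<p)

      mul-inverseʳ : ∀ x → x < p → mul m (mul (inv m) x) ≡ x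
      mul-inverseʳ x x<p = trans
        (trans (*-congˡ-≈ m (%-≈ (inv m * x))) (*-inverse-assoc′ m x u)) (m<n⇒m%n≡m x<p)

      ∏-mul : ∀ F → ∏ p F ≈ ∏ p (F ∘ mul m)
      ∏-mul F = ∏-reindex p F (mul< m) (mul< (inv m)) mul-inverseˡ mul-inverseʳ

      count-mul : ∀ b → count p b ≡ count p (b ∘ mul m)
      count-mul b = ∑ℕ-reindex p (λ x → b x ⇒ℕ 1) (mul< m) (mul< (inv m)) mul-inverseˡ mul-inverseʳ

    ∏-pow : ∀ n (b : ℕ → Bool) a (F : ℕ → ℕ) →
      ∏ n (λ x → b x ⇒ a * F x) ≡ a ^ count n b * ∏ n (λ x → b x ⇒ F x)
    ∏-pow zero    b a F = refl
    ∏-pow (suc n) b a F with b 0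
    ... | false = trans (*-identityˡ _) (trans (∏-pow n (b ∘ suc) a (F ∘ suc)) (cong (a ^ count n (b ∘ suc) *_) (sym (*-identityˡ _))))
    ... | true  = trans (cong (a * F 0 *_) (∏-pow n (b ∘ suc) a (F ∘ suc)))
                    (shuffle a (F 0) (a ^ count n (b ∘ suc)) (∏ n (λ x → b (suc x) ⇒ F (suc x))))
      where
      shuffle : ∀ a f q r → a * f * (q * r) ≡ a * q * (f * r)
      shuffle = solve-∀

    ∏-unit : ∀ n F → (∀ x → x < n → Unit (F x)) → Unit (∏ n F)
    ∏-unit zero    F u = Unit-1
    ∏-unit (suc n) F u = Unit-* {F 0} (u 0 z<s) (∏-unit n (F ∘ suc) (λ x x<n → u (suc x) (s<s x<n)))

    -- Under the reindexing y = mx each member of the set releases one factor m. For the set of all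
    -- units this yields Fermat's theorem, for the lower half Gauss's lemma.
    gauss : ∀ {m} → Unit m → (b : ℕ → Bool) →
      ∏ p (λ y → b y ⇒ y) ≈ m ^ count p b * ∏ p (λ x → b (mul m x) ⇒ x)
    gauss {m} u b = begin
      ∏ p (λ y → b y ⇒ y)                      ≈⟨ ∏-mul u (λ y → b y ⇒ y) ⟩
      ∏ p (λ x → b (mul m x) ⇒ mul m x)        ≈⟨ ∏-cong p (λ x _ → under (b (mul m x)) (%-≈ (m * x))) ⟩
      ∏ p (λ x → b (mul m x) ⇒ m * x)          ≡⟨ ∏-pow p (b ∘ mul m) m (λ x → x) ⟩
      m ^ count p (b ∘ mul m) * rest           ≡⟨ cong (λ c → m ^ c * rest) (count-mul u b) ⟨
      m ^ count p b * rest                     ∎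
      where
      rest = ∏ p (λ x → b (mul m x) ⇒ x)
      under : ∀ b {x y} → x ≈ y → (b ⇒ x) ≈ (b ⇒ y)
      under true  e = e
      under false e = refl

    nonzero : ℕ → Bool
    nonzero zero    = false
    nonzero (suc _) = true

    nonzero-mul : ∀ {m} → Unit m → ∀ x → x < p → nonzero (mul m x) ≡ nonzero x
    nonzero-mul {m} u zero    _   = cong nonzero (trans (cong (_% p) (*-zeroʳ m)) (0%p≡0))
    nonzero-mul {m} u (suc x) x<p with mul m (suc x) in eq
    ... | zero  = contradiction eq (Unit-* {m} u (≢0⇒Unit x<p λ ()))
    ... | suc _ = refl

    count-true : ∀ n → count n (λ _ → true) ≡ n
    count-true zero    = refl
    count-true (suc n) = cong suc (count-true n)

    count-nonzero : count p nonzero ≡ neg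
    count-nonzero = trans (cong (λ q → count q nonzero) p≡1+neg) (count-true neg)

    -- The value 1 at 0 makes the product over [0, p) equal to (p - 1)!.
    units : ℕ → ℕ
    units x = nonzero x ⇒ x

    units-unit : ∀ x → x < p → Unit (units x)
    units-unit zero    _   = Unit-1
    units-unit (suc x) x<p = ≢0⇒Unit x<p λ ()

    fermat : ∀ {m} → Unit m → m ^ neg ≈ 1
    fermat {m} u = sym (*-cancelˡ-≈ (∏ p units) (∏-unit p units units-unit) (begin
      ∏ p units * 1                       ≡⟨ *-identityʳ _ ⟩
      ∏ p units                           ≈⟨ gauss u nonzero ⟩
      m ^ count p nonzero * ∏ p (λ x → nonzero (mul m x) ⇒ x)
        ≈⟨ *-congˡ-≈ (m ^ count p nonzero) (∏-cong p λ x x<p → cong (λ b → (b ⇒ x) % p) (nonzero-mul u x x<p)) ⟩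
      m ^ count p nonzero * ∏ p units     ≡⟨ cong (λ c → m ^ c * ∏ p units) count-nonzero ⟩
      m ^ neg * ∏ p units                 ≡⟨ *-comm (m ^ neg) _ ⟩
      ∏ p units * m ^ neg                 ∎))

  open Residues

  -- Wilson's theorem, Euler's criterion, multiplicativity of the Legendre symbol.

  module Legendre where
    open CommutativeMonoid *-commutativeMonoid-≈ using (setoid)
    open import Relation.Binary.Reasoning.Setoid setoid

    units-nonzero : ∀ {x} → x ≢ 0 → units x ≡ x
    units-nonzero {zero}  n = contradiction refl n
    units-nonzero {suc x} n = refl

    ⇒-cong : ∀ b {x y} → (b ≡ true → x ≈ y) → (b ⇒ x) ≈ (b ⇒ y)
    ⇒-cong true  e = e refl
    ⇒-cong false e = refl

    ⇒-1 : ∀ b → (b ⇒ 1) ≡ 1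
    ⇒-1 true  = refl
    ⇒-1 false = refl

    module Pairing {a} (ua : Unit a) where
      σ : ℕ → ℕ
      σ x = a * inv x % p

      σ-0 : σ 0 ≡ 0
      σ-0 = trans (cong (λ y → a * y % p) inv-0) (trans (cong (_% p) (*-zeroʳ a)) 0%p≡0)

      σ< : ∀ x → x < p → σ x < p
      σ< x _ = m%n<n (a * inv x) p

      x*σx≈a : ∀ {x} → Unit x → x * σ x ≈ a
      x*σx≈a {x} u = begin
        x * (a * inv x % p)  ≈⟨ *-congˡ-≈ x (%-≈ (a * inv x)) ⟩
        x * (a * inv x)      ≡⟨ shuffle x a (inv x) ⟩
        a * (x * inv x)      ≈⟨ *-congˡ-≈ a (*-inverseʳ x u) ⟩
        a * 1                ≡⟨ *-identityʳ a ⟩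
        a                    ∎
        where
        shuffle : ∀ x a y → x * (a * y) ≡ a * (x * y)
        shuffle = solve-∀

      σ-involutive : ∀ x → x < p → σ (σ x) ≡ x
      σ-involutive zero    _   = trans (cong σ σ-0) σ-0
      σ-involutive x@(suc _) x<p = ≈⇒≡ (σ< (σ x) (σ< x x<p)) x<p
        (*-cancelˡ-≈ (σ x) uσ (begin
          σ x * σ (σ x)  ≈⟨ x*σx≈a uσ ⟩
          a              ≈⟨ x*σx≈a u ⟨
          x * σ x        ≡⟨ *-comm x (σ x) ⟩
          σ x * x        ∎))
        where
        u : Unit x
        u = ≢0⇒Unit x<p λ ()
        uσ : Unit (σ x)
        uσ = Unit-*ʳ {x} (Unit-≈ {a} (sym (x*σx≈a u)) ua)

      fixed⇒root : ∀ {x} → Unit x → x ≡ σ x → x * x ≈ a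
      fixed⇒root {x} u e = trans (cong (λ y → x * y % p) e) (x*σx≈a u)

      paired : ∀ x → x < p →
        (does (x <? σ x) ⇒ units x * units (σ x)) ≈ (does (x <? σ x) ⇒ a)
      paired x x<p = ⇒-cong (does (x <? σ x)) (nontrivial x x<p)
        where
        nontrivial : ∀ x → x < p → does (x <? σ x) ≡ true → units x * units (σ x) ≈ a
        nontrivial zero    _   t = contradiction (trans (sym t) (cong (λ y → does (0 <? y)) σ-0)) λ ()
        nontrivial x@(suc _) x<p _ = trans (cong (λ y → x * y % p) (units-nonzero σx≢0)) (x*σx≈a u)
          where
          u = ≢0⇒Unit {x} x<p λ ()
          σx≢0 : σ x ≢ 0
          σx≢0 e = contradiction
            (trans (sym (x*σx≈a u)) (trans (cong (λ y → x * y % p) e) (trans (cong (_% p) (*-zeroʳ x)) 0%p≡0))) ua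

      -- Each pair {x, a/x} contributes a. The fixed points are the square roots of a, together with
      -- 0, whose factor is 1.
      ∏-units : ∏ p units ≈ a ^ count p (λ x → does (x <? σ x)) * ∏ p (λ x → does (x ≟ σ x) ⇒ units x)
      ∏-units = begin
        ∏ p units  ≈⟨ ∏-involution p units σ< σ-involutive ⟩
        ∏ p (λ x → up x ⇒ units x * units (σ x)) * fixed
          ≈⟨ *-congʳ-≈ fixed (∏-cong p paired) ⟩
        ∏ p (λ x → up x ⇒ a) * fixed
          ≈⟨ *-congʳ-≈ fixed (∏-cong p λ x _ → cong (λ c → (up x ⇒ c) % p) (sym (*-identityʳ a))) ⟩
        ∏ p (λ x → up x ⇒ a * 1) * fixed
          ≡⟨ cong (_* fixed) (∏-pow p up a (λ _ → 1)) ⟩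
        a ^ count p up * ∏ p (λ x → up x ⇒ 1) * fixed
          ≈⟨ *-congʳ-≈ fixed (*-congˡ-≈ (a ^ count p up) (trans (∏-cong p λ x _ → cong (_% p) (⇒-1 (up x))) (∏-1 p))) ⟩
        a ^ count p up * 1 * fixed
          ≡⟨ cong (_* fixed) (*-identityʳ (a ^ count p up)) ⟩
        a ^ count p up * fixed ∎
        where
        up = λ x → does (x <? σ x)
        fixed = ∏ p (λ x → does (x ≟ σ x) ⇒ units x)

    p≈0 : p ≈ 0
    p≈0 = trans (n%n≡0 p) (sym 0%p≡0)

    -- With x = y + 1, the difference x² - 1 is y (y + 2), free of subtraction, and p divides one of
    -- the factors. Since y + 2 ≤ p, the second can only be p itself.
    root-1 : ∀ {x} → x < p → x * x ≈ 1 → x ≡ 1 ⊎ x ≡ neg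
    root-1 {zero}  _   e = contradiction (trans (sym e) 0%p≡0) Unit-1
    root-1 {suc y} x<p e with euclidsLemma y (2 + y) prime (m%n≡0⇒n∣m _ p (trans factored 0%p≡0))
      where
      expand : ∀ y n → y * (2 + y) + (1 + n) ≡ suc y * suc y + n
      expand = solve-∀
      factored : y * (2 + y) ≈ 0
      factored = begin
        y * (2 + y)               ≈⟨ [m+n]%n≡m%n (y * (2 + y)) p ⟨
        y * (2 + y) + p           ≡⟨ cong (λ q → y * (2 + y) + q) p≡1+neg ⟩
        y * (2 + y) + (1 + neg)   ≡⟨ expand y neg ⟩
        suc y * suc y + neg       ≈⟨ +-cong-≈ {suc y * suc y} {1} {neg} {neg} e refl ⟩
        1 + neg                   ≡⟨ p≡1+neg ⟨
        p                         ≈⟨ p≈0 ⟩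
        0                         ∎
    ... | inj₁ d = inj₁ (cong suc (trans (sym (m<n⇒m%n≡m (<-trans ≤-refl x<p))) (n∣m⇒m%n≡0 y p d)))
    ... | inj₂ d = inj₂ (suc-injective (trans (≤-antisym x<p (∣⇒≤ d)) p≡1+neg))

    -- Pairing with a = 1: the pairs contribute 1, and of the fixed units 1 and -1 only -1 shows in
    -- the product.
    wilson : ∏ p units ≈ neg
    wilson = begin
      ∏ p units                                      ≈⟨ ∏-units ⟩
      1 ^ count p up * ∏ p (λ x → does (x ≟ σ x) ⇒ units x)
        ≡⟨ cong (_* ∏ p (λ x → does (x ≟ σ x) ⇒ units x)) (^-zeroˡ (count p up)) ⟩
      1 * ∏ p (λ x → does (x ≟ σ x) ⇒ units x)       ≡⟨ *-identityˡ _ ⟩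
      ∏ p (λ x → does (x ≟ σ x) ⇒ units x)           ≈⟨ ∏-cong p fixed ⟩
      ∏ p (λ x → (x ≡ᵇ neg) ⇒ neg)                   ≈⟨ ∏-delta p neg neg neg<p ⟩
      neg                                            ∎
      where
      open Pairing Unit-1
      up : ℕ → Bool
      up x = does (x <? σ x)
      unit-neg : Unit neg
      unit-neg e = Unit-1 (trans (sym neg*neg≈1) (trans (*-cong-≈ {neg} {0} {neg} {0} (trans e (sym 0%p≡0)) (trans e (sym 0%p≡0))) 0%p≡0))
      neg-fixed : neg ≡ σ neg
      neg-fixed = ≈⇒≡ neg<p (σ< neg neg<p) (*-cancelˡ-≈ neg unit-neg (trans neg*neg≈1 (sym (x*σx≈a unit-neg))))
      neg≢0 : neg ≢ 0
      neg≢0 e = unit-neg (trans (cong (_% p) e) 0%p≡0)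
      fixed-≢neg : ∀ x → x < p → x ≢ neg → (does (x ≟ σ x) ⇒ units x) ≈ 1
      fixed-≢neg x x<p x≢neg = trans (⇒-cong (does (x ≟ σ x)) (root x x<p x≢neg)) (cong (_% p) (⇒-1 (does (x ≟ σ x))))
        where
        root : ∀ x → x < p → x ≢ neg → does (x ≟ σ x) ≡ true → units x ≈ 1
        root zero      _   _     _ = refl
        root x@(suc _) x<p x≢neg t with root-1 x<p (fixed⇒root (≢0⇒Unit x<p λ ()) (≡ᵇ⇒≡ x (σ x) (subst T (sym t) _)))
        ... | inj₁ x≡1   = cong (_% p) x≡1
        ... | inj₂ x≡neg = contradiction x≡neg x≢neg
      fixed : ∀ x → x < p → (does (x ≟ σ x) ⇒ units x) ≈ ((x ≡ᵇ neg) ⇒ neg)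
      fixed x x<p with x ≟ neg
      ... | yes refl rewrite dec-true (neg ≟ σ neg) neg-fixed | dec-true (neg ≟ neg) refl = cong (_% p) (units-nonzero neg≢0)
      ... | no x≢neg rewrite dec-false (x ≟ neg) x≢neg = fixed-≢neg x x<p x≢neg

    -- As p is odd, this is (p - 1)/2, the exponent in Euler's criterion.
    h : ℕ
    h = p / 2

    neg≡h*2 : neg ≡ h * 2
    neg≡h*2 with p % 2 in eq | m%n<n p 2 | m≡m%n+[m/n]*n p 2
    ... | 1 | _ | e = suc-injective (trans (sym p≡1+neg) e)
    ... | 0 | _ | e with prime⇒irreducible prime (m%n≡0⇒n∣m p 2 eq)
    ...   | inj₂ 2≡p = contradiction 2≡p (<⇒≢ 2<p)
    neg≡h*2 | suc (suc _) | s≤s (s≤s ()) | _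

    square-power : ∀ {x y} → Unit x → y * y ≈ x → x ^ h ≈ 1
    square-power {x} {y} u e = begin
      x ^ h          ≈⟨ ^-cong-≈ h e ⟨
      (y * y) ^ h    ≡⟨ cong (λ z → (y * z) ^ h) (*-identityʳ y) ⟨
      (y ^ 2) ^ h    ≡⟨ ^-*-assoc y 2 h ⟩
      y ^ (2 * h)    ≡⟨ cong (y ^_) (trans (*-comm 2 h) (sym neg≡h*2)) ⟩
      y ^ neg        ≈⟨ fermat (Unit-*ˡ {y} {y} (Unit-≈ (sym e) u)) ⟩
      1              ∎

    -- Without square roots of a no unit is fixed, so (p - 1)! is a raised to the number of pairs,
    -- and Wilson's theorem evaluates it.
    nonsquare-power : ∀ {a} → Unit a → (∀ y → ¬ (y * y ≈ a)) → a ^ h ≈ neg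
    nonsquare-power {a} ua nonsquare = begin
      a ^ h                   ≡⟨ cong (a ^_) h≡count ⟩
      a ^ count p up          ≡⟨ *-identityʳ _ ⟨
      a ^ count p up * 1      ≈⟨ *-congˡ-≈ (a ^ count p up) (trans (∏-cong p (λ x x<p → cong (_% p) (fixed x x<p))) (∏-1 p)) ⟨
      a ^ count p up * ∏ p (λ x → does (x ≟ σ x) ⇒ units x)  ≈⟨ ∏-units ⟨
      ∏ p units               ≈⟨ wilson ⟩
      neg                     ∎
      where
      open Pairing ua
      up : ℕ → Bool
      up x = does (x <? σ x)
      unfixed : ∀ x → suc x < p → suc x ≢ σ (suc x)
      unfixed x x<p e = nonsquare (suc x) (fixed⇒root (≢0⇒Unit x<p λ ()) e)
      fixed : ∀ x → x < p → (does (x ≟ σ x) ⇒ units x) ≡ 1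
      fixed zero    _ = ⇒-1 (does (0 ≟ σ 0))
      fixed (suc x) x<p rewrite dec-false (suc x ≟ σ (suc x)) (unfixed x x<p) = refl
      fixed-count : ∀ x → x < p → (does (x ≟ σ x) ⇒ℕ 1) ≡ ((x ≡ᵇ 0) ⇒ℕ 1)
      fixed-count zero    _ rewrite σ-0 = refl
      fixed-count (suc x) x<p rewrite dec-false (suc x ≟ σ (suc x)) (unfixed x x<p) = refl
      up2 : ∀ n b → ∑ℕ n (λ x → b x ⇒ℕ 2) ≡ count n b * 2
      up2 zero    b = refl
      up2 (suc n) b with b 0
      ... | true  = cong (λ c → 2 + c) (up2 n (b ∘ suc))
      ... | false = up2 n (b ∘ suc)
      -- The extra 1 is the fixed point 0, so the p - 1 units form exactly h pairs.
      p≡ : p ≡ count p up * 2 + 1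
      p≡ = trans (sym (count-true p)) (trans (∑ℕ-involution p (λ _ → 1) σ< σ-involutive)
        (cong₂ _+_ (up2 p up) (trans (∑ℕ-cong p fixed-count) (∑ℕ-delta p 0 1 (<-trans z<s 1<p)))))
      h≡count : h ≡ count p up
      h≡count = *-cancelʳ-≡ h (count p up) 2 (trans (sym neg≡h*2)
        (suc-injective (trans (sym p≡1+neg) (trans p≡ (+-comm (count p up * 2) 1)))))

    ∣+-+∣≡∸ : ∀ {a b} → a ≤ b → ℤ.∣ + a ℤ.- + b ∣ ≡ b ∸ a
    ∣+-+∣≡∸ {a} {b} a≤b = trans (cong ℤ.∣_∣ (ℤ.m-n≡m⊖n a b)) (ℤ.∣⊖∣-≤ a≤b)

    ∣∸⇒≈ : ∀ {a b} → a ≤ b → p ∣ b ∸ a → a ≈ b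
    ∣∸⇒≈ {a} {b} a≤b d = sym (trans (cong (_% p) (sym (m∸n+n≡m a≤b))) (%-remove-+ˡ a d))

    ≈⇒∣∸ : ∀ {a b} → a ≈ b → p ∣ b ∸ a
    ≈⇒∣∸ {a} {b} e = divides (b / p ∸ a / p) (R.begin
      b ∸ a                                          R.≡⟨ cong₂ _∸_ (m≡m%n+[m/n]*n b p) (m≡m%n+[m/n]*n a p) ⟩
      (b % p + b / p * p) ∸ (a % p + a / p * p)      R.≡⟨ cong (λ r → (r + b / p * p) ∸ (a % p + a / p * p)) e ⟨
      (a % p + b / p * p) ∸ (a % p + a / p * p)      R.≡⟨ [m+n]∸[m+o]≡n∸o (a % p) _ _ ⟩
      b / p * p ∸ a / p * p                          R.≡⟨ *-distribʳ-∸ p (b / p) (a / p) ⟨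
      (b / p ∸ a / p) * p                            R.∎)
      where module R = ≡-Reasoning

    ∣-∣⇒≈ : ∀ a b → p ∣ ℤ.∣ + a ℤ.- + b ∣ → a ≈ b
    ∣-∣⇒≈ a b d with ≤-total a b
    ... | inj₁ a≤b = ∣∸⇒≈ a≤b (subst (p ∣_) (∣+-+∣≡∸ a≤b) d)
    ... | inj₂ b≤a = sym (∣∸⇒≈ b≤a (subst (p ∣_) (trans (ℤ.∣i-j∣≡∣j-i∣ (+ a) (+ b)) (∣+-+∣≡∸ b≤a)) d))

    ≈⇒∣-∣ : ∀ {a b} → a ≈ b → p ∣ ℤ.∣ + a ℤ.- + b ∣
    ≈⇒∣-∣ {a} {b} e with ≤-total a b
    ... | inj₁ a≤b = subst (p ∣_) (sym (∣+-+∣≡∸ a≤b)) (≈⇒∣∸ e)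
    ... | inj₂ b≤a = subst (p ∣_) (sym (trans (ℤ.∣i-j∣≡∣j-i∣ (+ a) (+ b)) (∣+-+∣≡∸ b≤a))) (≈⇒∣∸ (sym e))

    does-sound : ∀ {A : Set} (a? : Dec A) → T (does a?) → A
    does-sound (yes a) _ = a

    isSq-sound : ∀ x → T (isSqModB p x) → ∃ λ y → y * y ≈ x
    isSq-sound x t with find (any⁻ _ (upTo p) t)
    ... | y , _ , d = y , ∣-∣⇒≈ (y * y) x (does-sound (p ∣? _) d)

    isSq-complete : ∀ x y → y * y ≈ x → T (isSqModB p x)
    isSq-complete x y e = any⁺ _ (lose (∈-upTo⁺ (m%n<n y p))
      (subst T (sym (dec-true (p ∣? _) (≈⇒∣-∣ {y % p * (y % p)} {x} (trans (*-cong-≈ {y % p} {y} {y % p} {y} (%-≈ y) (%-≈ y)) e)))) _))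

    χ : ℕ → ℤ
    χ = legendre p

    legendre-0 : ∀ {x} → x % p ≡ 0 → χ x ≡ 0ℤ
    legendre-0 {x} e rewrite dec-true (p ∣? x) (m%n≡0⇒n∣m x p e) = refl

    -- Ties together the symbol, the Boolean test and the Euler power, so that one case split
    -- delivers all three.
    data Class (x : ℕ) : Set where
      residue    : χ x ≡ 1ℤ → isNonResB p x ≡ false → x ^ h ≈ 1 → Class x
      nonresidue : χ x ≡ -1ℤ → isNonResB p x ≡ true → x ^ h ≈ neg → Class x

    classify : ∀ x → Unit x → Class x
    classify x u with isSqModB p x in eq
    ... | true  = residue
      (cong₂ (λ d s → if d then + 0 else (if s then + 1 else - (+ 1))) not-div eq)
      (cong₂ (λ d s → not d ∧ not s) not-div eq)
      (square-power {y = proj₁ (isSq-sound x (subst T (sym eq) _))} u (proj₂ (isSq-sound x (subst T (sym eq) _))))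
      where
      not-div : divB p x ≡ false
      not-div = dec-false (p ∣? x) (u ∘ n∣m⇒m%n≡0 x p)
    ... | false = nonresidue
      (cong₂ (λ d s → if d then + 0 else (if s then + 1 else - (+ 1))) not-div eq)
      (cong₂ (λ d s → not d ∧ not s) not-div eq)
      (nonsquare-power u (λ y e → subst T eq (isSq-complete x y e)))
      where
      not-div : divB p x ≡ false
      not-div = dec-false (p ∣? x) (u ∘ n∣m⇒m%n≡0 x p)

    legendre-1 : ∀ {x} → Unit x → x ^ h ≈ 1 → χ x ≡ 1ℤ
    legendre-1 {x} u e with classify x u
    ... | residue χx _ _    = χx
    ... | nonresidue _ _ e′ = contradiction (trans (sym e) e′) 1≉neg

    legendre-neg1 : ∀ {x} → Unit x → x ^ h ≈ neg → χ x ≡ -1ℤ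
    legendre-neg1 {x} u e with classify x u
    ... | residue _ _ e′    = contradiction (trans (sym e′) e) 1≉neg
    ... | nonresidue χx _ _ = χx

    ^-distribʳ-* : ∀ n x y → (x * y) ^ n ≡ x ^ n * y ^ n
    ^-distribʳ-* zero    x y = refl
    ^-distribʳ-* (suc n) x y = trans (cong (x * y *_) (^-distribʳ-* n x y)) (shuffle x y (x ^ n) (y ^ n))
      where
      shuffle : ∀ x y a b → x * y * (a * b) ≡ x * a * (y * b)
      shuffle = solve-∀

    ^-*-≈ : ∀ x y → mul x y ^ h ≈ x ^ h * y ^ h
    ^-*-≈ x y = trans (^-cong-≈ h (%-≈ (x * y))) (cong (_% p) (^-distribʳ-* h x y))

    legendre-mul : ∀ {x} → Unit x → ∀ y → y < p → χ (mul x y) ≡ χ x ℤ.* χ y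
    legendre-mul {x} ux zero y<p = trans (legendre-0 (trans (%-≈ (x * 0)) (trans (cong (_% p) (*-zeroʳ x)) 0%p≡0)))
      (sym (trans (cong (χ x ℤ.*_) (legendre-0 0%p≡0)) (ℤ.*-zeroʳ (χ x))))
    legendre-mul {x} ux y@(suc _) y<p = help (classify x ux) (classify y uy)
      where
      uy : Unit y
      uy = ≢0⇒Unit y<p λ ()
      uxy : Unit (mul x y)
      uxy = Unit-≈ (sym (%-≈ (x * y))) (Unit-* {x} ux uy)
      help : Class x → Class y → χ (mul x y) ≡ χ x ℤ.* χ y
      help (residue a _ e) (residue b _ f) = trans
        (legendre-1 uxy (trans (^-*-≈ x y) (*-cong-≈ {x ^ h} {1} e f))) (sym (cong₂ ℤ._*_ a b))
      help (residue a _ e) (nonresidue b _ f) = trans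
        (legendre-neg1 uxy (trans (^-*-≈ x y) (trans (*-cong-≈ {x ^ h} {1} e f) (cong (_% p) (*-identityˡ neg))))) (sym (cong₂ ℤ._*_ a b))
      help (nonresidue a _ e) (residue b _ f) = trans
        (legendre-neg1 uxy (trans (^-*-≈ x y) (trans (*-cong-≈ {x ^ h} {neg} e f) (cong (_% p) (*-identityʳ neg))))) (sym (cong₂ ℤ._*_ a b))
      help (nonresidue a _ e) (nonresidue b _ f) = trans
        (legendre-1 uxy (trans (^-*-≈ x y) (trans (*-cong-≈ {x ^ h} {neg} e f) neg*neg≈1))) (sym (cong₂ ℤ._*_ a b))

  open Legendre

  -- The twelve cells under multiplication by 2, 3 and -1, and their sizes.

  module Cells where
    unit≤10 : ∀ m → {{NonZero m}} → m ≤ 10 → Unit m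
    unit≤10 m m≤10 = ≢0⇒Unit (≤-<-trans m≤10 10<p) (≢-nonZero⁻¹ m)

    unit-2 : Unit 2
    unit-2 = unit≤10 2 (s≤s (s≤s z≤n))

    unit-3 : Unit 3
    unit-3 = unit≤10 3 (s≤s (s≤s (s≤s z≤n)))

    -- Ensures that no unit lies on a cell boundary: 12x = ip would make p divide 12x.
    unit-12 : Unit 12
    unit-12 = Unit-* {3} {4} unit-3 (unit≤10 4 (s≤s (s≤s (s≤s (s≤s z≤n)))))

    cell : ℕ → ℕ
    cell x = 12 * x / p

    cell<12 : ∀ {x} → x < p → cell x < 12
    cell<12 {x} x<p = m<n*o⇒m/o<n (*-monoʳ-< 12 x<p)

    module _ {m d : ℕ} .{{_ : NonZero m}} .{{_ : NonZero d}} (d*m≡12 : d * m ≡ 12) where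
      private instance
        _ = m*n≢0 p m
        _ = m*n≢0 p d

      -- Let y be the residue of mx. Dividing 12y = dmy by pm gives ⌊dy/p⌋, which is below d. Since
      -- dy differs from dmx = 12x by a multiple of dp, this quotient agrees with ⌊12x/p⌋ modulo d.
      cell-mul-/ : ∀ x → cell (mul m x) / m ≡ cell x % d
      cell-mul-/ x = begin
        12 * y / p / m                  ≡⟨ m/n/o≡m/[n*o] (12 * y) p m ⟩
        12 * y / (p * m)                ≡⟨ /-congˡ {o = p * m} (trans (cong (_* y) (sym d*m≡12)) (swap d m y)) ⟩
        d * y * m / (p * m)             ≡⟨ m*n/o*n≡m/o (d * y) m p ⟩
        d * y / p                       ≡⟨ m<n⇒m%n≡m {n = d} (m<n*o⇒m/o<n {n = d} {o = p} (*-monoʳ-< d (m%n<n (m * x) p))) ⟨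
        d * y / p % d                   ≡⟨ [m+kn]%n≡m%n (d * y / p) q d ⟨
        (d * y / p + q * d) % d         ≡⟨ cong (λ t → (d * y / p + t) % d) (trans (*-comm q d) (sym (m*n/n≡m (d * q) p))) ⟩
        (d * y / p + d * q * p / p) % d ≡⟨ cong (_% d) (+-distrib-/-∣ʳ (d * y) {d = p} (n∣m*n (d * q))) ⟨
        (d * y + d * q * p) / p % d     ≡⟨ cong (λ t → t / p % d) (trans (expand d y q p) (cong (d *_) (sym (m≡m%n+[m/n]*n (m * x) p)))) ⟩
        d * (m * x) / p % d             ≡⟨ cong (λ t → t / p % d) (trans (sym (*-assoc d m x)) (cong (_* x) d*m≡12)) ⟩
        12 * x / p % d                  ∎
        where
        open ≡-Reasoning
        y = mul m x
        q = m * x / p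
        swap : ∀ d m y → d * m * y ≡ d * y * m
        swap = solve-∀
        expand : ∀ d y q p → d * y + d * q * p ≡ d * (y + q * p)
        expand = solve-∀

    unit-neg : Unit neg
    unit-neg e = 1+n≢0 {p ∸ 2} (trans (sym (+-∸-assoc 1 {p} {2} (<⇒≤ 2<p))) (trans (sym (m<n⇒m%n≡m neg<p)) e))

    mul-neg : ∀ x → suc x < p → mul neg (suc x) + suc x ≡ p
    mul-neg x x<p = begin
      mul neg (suc x) + suc x  ≡⟨ cong (_+ suc x) (trans (cong (_% p) neg*suc) (trans ([m+kn]%n≡m%n w x p) (m<n⇒m%n≡m (≤-<-trans (m∸n≤m neg x) neg<p)))) ⟩
      w + suc x                ≡⟨ +-suc w x ⟩
      suc (w + x)              ≡⟨ cong suc w+x ⟩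
      suc neg                  ≡⟨ p≡1+neg ⟨
      p                        ∎
      where
      open ≡-Reasoning
      w = neg ∸ x
      w+x : w + x ≡ neg
      w+x = m∸n+n≡m (<⇒≤ (s<s⁻¹ (subst (suc x <_) p≡1+neg x<p)))
      neg*suc : neg * suc x ≡ w + x * p
      neg*suc = begin
        neg * suc x             ≡⟨ *-suc neg x ⟩
        neg + neg * x           ≡⟨ cong (_+ neg * x) w+x ⟨
        w + x + neg * x         ≡⟨ collect w x neg ⟩
        w + x * suc neg         ≡⟨ cong (λ q → w + x * q) p≡1+neg ⟨
        w + x * p               ∎
        where
        collect : ∀ w x n → w + x + n * x ≡ w + x * suc n
        collect = solve-∀

    /-unique : ∀ {n q r} → r < p → n ≡ q * p + r → n / p ≡ q
    /-unique {n} {q} {r} r<p refl = begin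
      (q * p + r) / p    ≡⟨ +-distrib-/-∣ˡ r (n∣m*n q) ⟩
      q * p / p + r / p  ≡⟨ cong₂ _+_ (m*n/n≡m q p) (m<n⇒m/n≡0 r<p) ⟩
      q + 0              ≡⟨ +-identityʳ q ⟩
      q                  ∎
      where open ≡-Reasoning

    -- If a unit u has 12u = cp + r, then 12(p - u) = (11 - c)p + (p - r); as r is not 0, p - r is a
    -- genuine remainder.
    cell-neg : ∀ x → suc x < p → cell (mul neg (suc x)) ≡ 11 ∸ cell (suc x)
    cell-neg x x<p = /-unique {r = s} s<p (+-cancelʳ-≡ (12 * suc x) _ _ (begin
      12 * y + 12 * suc x         ≡⟨ *-distribˡ-+ 12 y (suc x) ⟨
      12 * (y + suc x)            ≡⟨ cong (12 *_) (mul-neg x x<p) ⟩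
      12 * p                      ≡⟨ cong (λ n → suc n * p) k+c ⟨
      suc (k + c) * p             ≡⟨ expand k c p ⟩
      k * p + p + c * p           ≡⟨ cong (λ q → k * p + q + c * p) s+r ⟨
      k * p + (s + r) + c * p     ≡⟨ collect (k * p) s r (c * p) ⟩
      k * p + s + (r + c * p)     ≡⟨ cong (λ t → k * p + s + t) (m≡m%n+[m/n]*n (12 * suc x) p) ⟨
      k * p + s + 12 * suc x      ∎))
      where
      open ≡-Reasoning
      y = mul neg (suc x)
      c = cell (suc x)
      k = 11 ∸ c
      r = 12 * suc x % p
      s = p ∸ r
      k+c : k + c ≡ 11
      k+c = m∸n+n≡m (s≤s⁻¹ (cell<12 x<p))
      r≢0 : Unit (12 * suc x)
      r≢0 = Unit-* {12} {suc x} unit-12 (≢0⇒Unit x<p λ ())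
      s+r : s + r ≡ p
      s+r = m∸n+n≡m (m%n≤n (12 * suc x) p)
      s<p : s < p
      s<p = ∸-monoʳ-< {p} {r} {0} (n≢0⇒n>0 r≢0) (m%n≤n (12 * suc x) p)
      expand : ∀ k c p → suc (k + c) * p ≡ k * p + p + c * p
      expand = solve-∀
      collect : ∀ a s r b → a + (s + r) + b ≡ a + s + (r + b)
      collect = solve-∀

    T-ext : ∀ {a b} → (T a → T b) → (T b → T a) → a ≡ b
    T-ext {false} {false} _ _ = refl
    T-ext {false} {true}  _ g with () ← g _
    T-ext {true}  {false} f _ with () ← f _
    T-ext {true}  {true}  _ _ = refl

    count-<ᵇ : ∀ n f → f ≤ n → count n (_<ᵇ f) ≡ f
    count-<ᵇ zero    zero    _   = refl
    count-<ᵇ (suc n) zero    _   = count-<ᵇ n zero z≤n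
    count-<ᵇ (suc n) (suc f) f≤n = cong suc (count-<ᵇ n f (s≤s⁻¹ f≤n))

    count-cell< : ∀ i → i < 12 → count p (λ x → nonzero x ∧ (cell x <ᵇ i)) ≡ i * p / 12
    count-cell< i i<12 = trans (∑ℕ-cong p (λ x _ → cong (_⇒ℕ 1) (pointwise x)))
      -- Writing p as `suc neg` splits off x = 0, which is not counted, and the shift turns
      -- `suc x ≤ᵇ f` into `x <ᵇ f`.
      (trans (cong (λ q → count q (λ x → nonzero x ∧ (x ≤ᵇ f))) p≡1+neg) (count-<ᵇ neg f f≤neg))
      where
      f = i * p / 12
      f≤neg : f ≤ neg
      f≤neg = s≤s⁻¹ (subst (f <_) p≡1+neg (m<n*o⇒m/o<n (subst (i * p <_) (*-comm 12 p) (*-monoˡ-< p i<12))))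
      pointwise : ∀ x → (nonzero x ∧ (cell x <ᵇ i)) ≡ (nonzero x ∧ (x ≤ᵇ f))
      pointwise zero = refl
      pointwise x@(suc _) with x <? p
      ... | no  x≮p = T-ext
        (λ t → contradiction (<ᵇ⇒< (cell x) i t) (≤⇒≯ (≤-trans (<⇒≤ i<12) (subst (_≤ cell x) (m*n/n≡m 12 p) (/-monoˡ-≤ p (*-monoʳ-≤ 12 (≮⇒≥ x≮p)))))))
        (λ t → contradiction (≤-trans (≤ᵇ⇒≤ x f t) f≤neg) (<⇒≱ (<-≤-trans neg<p (≮⇒≥ x≮p))))
      ... | yes x<p = T-ext
        (λ t → ≤⇒≤ᵇ (subst (_≤ f) (m*n/n≡m x 12) (/-monoˡ-≤ 12 (subst (_≤ i * p) (*-comm 12 x)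
          (≮⇒≥ λ ip<12x → <⇒≱ (<ᵇ⇒< (cell x) i t) (subst (_≤ cell x) (m*n/n≡m i p) (/-monoˡ-≤ p (<⇒≤ ip<12x))))))))
        (λ t → <⇒<ᵇ (m<n*o⇒m/o<n {n = i} (≤∧≢⇒<
          (≤-trans (*-monoʳ-≤ 12 (≤ᵇ⇒≤ x f t)) (subst (_≤ i * p) (*-comm f 12) (m/n*n≤m (i * p) 12)))
          (λ e → Unit-* {12} {x} unit-12 (≢0⇒Unit x<p λ ()) (trans (cong (_% p) e) (m*n%n≡0 i p))))))

    band : ℕ → ℕ → ℕ → Bool
    band i j x = nonzero x ∧ ((i ≤ᵇ cell x) ∧ (cell x <ᵇ j))

    count-band : ∀ {i j} → i ≤ j → j < 12 → count p (band i j) + i * p / 12 ≡ j * p / 12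
    count-band {i} {j} i≤j j<12 = begin
      count p (band i j) + i * p / 12
        ≡⟨ cong (λ q → count p (band i j) + q) (count-cell< i (≤-<-trans i≤j j<12)) ⟨
      count p (band i j) + count p (λ x → nonzero x ∧ (cell x <ᵇ i))
        ≡⟨ ∑ℕ-+ p (λ x → band i j x ⇒ℕ 1) (λ x → (nonzero x ∧ (cell x <ᵇ i)) ⇒ℕ 1) ⟨
      ∑ℕ p (λ x → (band i j x ⇒ℕ 1) + ((nonzero x ∧ (cell x <ᵇ i)) ⇒ℕ 1))
        ≡⟨ ∑ℕ-cong p (λ x _ → split (nonzero x) (cell x)) ⟩
      count p (λ x → nonzero x ∧ (cell x <ᵇ j))
        ≡⟨ count-cell< j j<12 ⟩
      j * p / 12 ∎
      where
      open ≡-Reasoning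
      split : ∀ z c → ((z ∧ ((i ≤ᵇ c) ∧ (c <ᵇ j))) ⇒ℕ 1) + ((z ∧ (c <ᵇ i)) ⇒ℕ 1) ≡ ((z ∧ (c <ᵇ j)) ⇒ℕ 1)
      split false c = refl
      split true  c with <-≤-connex c i
      ... | inj₁ c<i rewrite dec-false (i ≤? c) (<⇒≱ c<i) | dec-true (c <? i) c<i | dec-true (c <? j) (<-≤-trans c<i i≤j) = refl
      ... | inj₂ i≤c rewrite dec-true (i ≤? c) i≤c | dec-false (c <? i) (≤⇒≯ i≤c) = +-identityʳ _

  open Cells

  -- Gauss's lemma for 2 and 3.

  module GaussLemma where
    open CommutativeMonoid *-commutativeMonoid-≈ using (setoid)
    open import Relation.Binary.Reasoning.Setoid setoid

    lowerHalf : ℕ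
    lowerHalf = ∏ p (λ x → (nonzero x ∧ (cell x <ᵇ 6)) ⇒ x)

    -- The members of w in the upper half are replaced by their negatives, which fill
    -- exactly the part of the lower half that w misses, the cells i ≤ c < j.
    ∏-fold : ∀ (w : ℕ → Bool) i j →
      {True (agree-below-12? Bool._≟_ (λ c → w (11 ∸ c) ∧ not (11 ∸ c <ᵇ 6)) (λ c → (i ≤ᵇ c) ∧ (c <ᵇ j)))} →
      {True (agree-below-12? Bool._≟_ (λ c → w c ∧ (c <ᵇ 6)) (λ c → (c <ᵇ 6) ∧ not ((i ≤ᵇ c) ∧ (c <ᵇ j))))} →
      {True (agree-below-12? Bool._≟_ (λ c → (i ≤ᵇ c) ∧ (c <ᵇ j)) (λ c → (c <ᵇ 6) ∧ ((i ≤ᵇ c) ∧ (c <ᵇ j))))} →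
      ∏ p (λ x → (nonzero x ∧ w (cell x)) ⇒ x) ≈ neg ^ count p (band i j) * lowerHalf
    ∏-fold w i j {upper?} {lower?} {band⊆low?} = begin
      ∏ p (λ x → (nonzero x ∧ w (cell x)) ⇒ x)
        ≈⟨ ∏-cong p (λ x _ → cong (_% p) (split (nonzero x) (w (cell x)) (cell x <ᵇ 6) x)) ⟩
      ∏ p (λ x → lo x * hi x)
        ≈⟨ ∏-* p lo hi ⟩
      ∏ p lo * ∏ p hi
        ≈⟨ *-congˡ-≈ (∏ p lo) (trans (∏-mul unit-neg hi) (∏-cong p reflect)) ⟩
      ∏ p lo * ∏ p (λ x → band i j x ⇒ neg * x)
        ≡⟨ cong (∏ p lo *_) (∏-pow p (band i j) neg (λ x → x)) ⟩
      ∏ p lo * (neg ^ count p (band i j) * ∏ p mid)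
        ≡⟨ shuffle (∏ p lo) (neg ^ count p (band i j)) (∏ p mid) ⟩
      neg ^ count p (band i j) * (∏ p lo * ∏ p mid)
        ≈⟨ *-congˡ-≈ (neg ^ count p (band i j)) (trans (sym (∏-* p lo mid)) (∏-cong p λ x x<p → cong (_% p) (merge x x<p))) ⟩
      neg ^ count p (band i j) * lowerHalf ∎
      where
      upper = λ {c} → toWitness upper? {c}
      lower = λ {c} → toWitness lower? {c}
      band⊆low = λ {c} → toWitness band⊆low? {c}
      lo hi mid : ℕ → ℕ
      lo x = (nonzero x ∧ (w (cell x) ∧ (cell x <ᵇ 6))) ⇒ x
      hi x = (nonzero x ∧ (w (cell x) ∧ not (cell x <ᵇ 6))) ⇒ x
      mid x = band i j x ⇒ x
      split : ∀ z a b x → ((z ∧ a) ⇒ x) ≡ ((z ∧ (a ∧ b)) ⇒ x) * ((z ∧ (a ∧ not b)) ⇒ x)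
      split false a     b     x = refl
      split true  false b     x = refl
      split true  true  false x = sym (*-identityˡ x)
      split true  true  true  x = sym (*-identityʳ x)
      reflect : ∀ x → x < p → hi (mul neg x) ≈ (band i j x ⇒ neg * x)
      reflect zero    x<p = cong (λ y → hi y % p) (trans (cong (_% p) (*-zeroʳ neg)) 0%p≡0)
      reflect x@(suc x′) x<p = trans (cong (λ z → ((z ∧ (w (cell (mul neg x)) ∧ not (cell (mul neg x) <ᵇ 6))) ⇒ mul neg x) % p) (nonzero-mul unit-neg x x<p))
        (trans (cong (λ c → ((w c ∧ not (c <ᵇ 6)) ⇒ mul neg x) % p) (cell-neg x′ x<p))
        (trans (cong (λ b → (b ⇒ mul neg x) % p) (upper (cell<12 x<p)))
          (⇒-cong ((i ≤ᵇ cell x) ∧ (cell x <ᵇ j)) (λ _ → %-≈ (neg * x)))))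
      shuffle : ∀ a b c → a * (b * c) ≡ b * (a * c)
      shuffle = solve-∀
      merge′ : ∀ z a b x → ((z ∧ (a ∧ not b)) ⇒ x) * ((z ∧ (a ∧ b)) ⇒ x) ≡ ((z ∧ a) ⇒ x)
      merge′ false a     b     x = refl
      merge′ true  false b     x = refl
      merge′ true  true  false x = *-identityʳ x
      merge′ true  true  true  x = *-identityˡ x
      merge : ∀ x → x < p → lo x * mid x ≡ ((nonzero x ∧ (cell x <ᵇ 6)) ⇒ x)
      merge x x<p = trans (cong₂ (λ a b → ((nonzero x ∧ a) ⇒ x) * ((nonzero x ∧ b) ⇒ x)) (lower (cell<12 x<p)) (band⊆low (cell<12 x<p)))
        (merge′ (nonzero x) (cell x <ᵇ 6) ((i ≤ᵇ cell x) ∧ (cell x <ᵇ j)) x)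

    -- Expressed through ⌊cell/m⌋, the lower half has as preimage under x ↦ mx a union of classes of
    -- cells modulo d. Folding that preimage back gives the same product up to sign, and cancelling
    -- `lowerHalf` leaves m^h times the sign.
    gauss-cells : ∀ {m d} .{{_ : NonZero m}} .{{_ : NonZero d}} → d * m ≡ 12 → Unit m →
      (v : ℕ → Bool) → {True (agree-below-12? Bool._≟_ (λ c → v (c / m)) (_<ᵇ 6))} → ∀ i j →
      ∏ p (λ x → (nonzero x ∧ v (cell x % d)) ⇒ x) ≈ neg ^ count p (band i j) * lowerHalf →
      m ^ h * neg ^ count p (band i j) ≈ 1
    gauss-cells {m} {d} d*m≡12 um v {low?} i j folded = sym (*-cancelˡ-≈ lowerHalf lowerHalf-unit (begin
      lowerHalf * 1                  ≡⟨ *-identityʳ lowerHalf ⟩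
      lowerHalf                      ≈⟨ ∏-cong p (λ x x<p → cong (λ b → ((nonzero x ∧ b) ⇒ x) % p) (low (cell<12 x<p))) ⟨
      ∏ p (λ x → set x ⇒ x)     ≈⟨ gauss um set ⟩
      m ^ count p set * ∏ p (λ x → set (mul m x) ⇒ x)
        ≈⟨ *-congˡ-≈ (m ^ count p set) (trans (∏-cong p λ x x<p → cong (λ b → (b ⇒ x) % p)
             (cong₂ _∧_ (nonzero-mul um x x<p) (cong v (cell-mul-/ d*m≡12 x)))) folded) ⟩
      m ^ count p set * (s * lowerHalf)  ≡⟨ cong (λ e → m ^ e * (s * lowerHalf)) count≡h ⟩
      m ^ h * (s * lowerHalf)        ≡⟨ shuffle (m ^ h) s lowerHalf ⟩
      lowerHalf * (m ^ h * s)        ∎))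
      where
      low = λ {c} → toWitness low? {c}
      s = neg ^ count p (band i j)
      set : ℕ → Bool
      set x = nonzero x ∧ v (cell x / m)
      count≡h : count p set ≡ h
      count≡h = trans (∑ℕ-cong p (λ x x<p → cong (λ b → (nonzero x ∧ b) ⇒ℕ 1) (low (cell<12 x<p))))
        (trans (count-cell< 6 (s≤s (s≤s (s≤s (s≤s (s≤s (s≤s (s≤s z≤n)))))))) (m*n/m*o≡n/o 6 p 2))
      lowerHalf-unit : Unit lowerHalf
      lowerHalf-unit = ∏-unit p _ unit
        where
        unit : ∀ x → x < p → Unit ((nonzero x ∧ (cell x <ᵇ 6)) ⇒ x)
        unit zero      _   = Unit-1
        unit x@(suc _) x<p with cell x <ᵇ 6
        ... | false = Unit-1
        ... | true  = ≢0⇒Unit x<p λ ()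
      shuffle : ∀ a b c → a * (b * c) ≡ c * (a * b)
      shuffle = solve-∀

    neg^even≈1 : ∀ n → neg ^ (2 * n) ≈ 1
    neg^even≈1 n = begin
      neg ^ (2 * n)     ≡⟨ ^-*-assoc neg 2 n ⟨
      (neg ^ 2) ^ n     ≡⟨ cong (λ t → (neg * t) ^ n) (*-identityʳ neg) ⟩
      (neg * neg) ^ n   ≈⟨ ^-cong-≈ n neg*neg≈1 ⟩
      1 ^ n             ≡⟨ ^-zeroˡ n ⟩
      1                 ∎

    legendre-even : ∀ {m} → Unit m → ∀ c n → c ≡ 2 * n → m ^ h * neg ^ c ≈ 1 → χ m ≡ 1ℤ
    legendre-even {m} um c n refl e = legendre-1 um (begin
      m ^ h                     ≡⟨ *-identityʳ (m ^ h) ⟨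
      m ^ h * 1                 ≈⟨ *-congˡ-≈ (m ^ h) (neg^even≈1 n) ⟨
      m ^ h * neg ^ (2 * n)     ≈⟨ e ⟩
      1                         ∎)

    -- Doubling takes the cells 0, 1, 2, 6, 7, 8 to the lower half; 6, 7, 8 reflect to 5, 4, 3, that
    -- is, to (p/4, p/2).
    legendre-2 : ∀ n → count p (band 3 6) ≡ 2 * n → χ 2 ≡ 1ℤ
    legendre-2 n e = legendre-even unit-2 _ n e
      (gauss-cells refl unit-2 (_<ᵇ 3) 3 6 (∏-fold (λ c → c % 6 <ᵇ 3) 3 6))

    -- Tripling takes the cells 0, 1, 4, 5, 8, 9 to the lower half; 8 and 9 reflect to 3 and 2, that
    -- is, to (p/6, p/3).
    legendre-3 : ∀ n → count p (band 2 4) ≡ 2 * n → χ 3 ≡ 1ℤ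
    legendre-3 n e = legendre-even unit-3 _ n e
      (gauss-cells refl unit-3 (_<ᵇ 2) 2 4 (∏-fold (λ c → c % 4 <ᵇ 2) 2 4))

  open GaussLemma

  -- Cell sums, distribution relations, and cell sizes for p = r + 24k.

  module CellSums where
    cellSum : (ℕ → ℤ) → ℕ → ℤ
    cellSum f i = ∑ℤ p (λ x → indicator (cell x ≡ᵇ i) ℤ.* f x)

    cellSums : (ℕ → ℤ) → List ℕ → ℤ
    cellSums f []      = 0ℤ
    cellSums f (i ∷ L) = cellSum f i ℤ.+ cellSums f L

    ∑-multiplicity : ∀ f L → ∑ℤ p (λ x → multiplicity L (cell x) ℤ.* f x) ≡ cellSums f L
    ∑-multiplicity f []      = trans (∑ℤ-cong p (λ x _ → ℤ.*-zeroˡ (f x))) (∑ℤ-0 p)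
    ∑-multiplicity f (i ∷ L) = begin
      ∑ℤ p (λ x → (indicator (cell x ≡ᵇ i) ℤ.+ multiplicity L (cell x)) ℤ.* f x)
        ≡⟨ ∑ℤ-cong p (λ x _ → ℤ.*-distribʳ-+ (f x) (indicator (cell x ≡ᵇ i)) (multiplicity L (cell x))) ⟩
      ∑ℤ p (λ x → indicator (cell x ≡ᵇ i) ℤ.* f x ℤ.+ multiplicity L (cell x) ℤ.* f x)
        ≡⟨ ∑ℤ-+ p (λ x → indicator (cell x ≡ᵇ i) ℤ.* f x) (λ x → multiplicity L (cell x) ℤ.* f x) ⟩
      cellSum f i ℤ.+ ∑ℤ p (λ x → multiplicity L (cell x) ℤ.* f x)
        ≡⟨ cong (λ t → cellSum f i ℤ.+ t) (∑-multiplicity f L) ⟩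
      cellSum f i ℤ.+ cellSums f L ∎
      where open ≡-Reasoning

    ∑-weighted : ∀ f w L {agree : True (agree-below-12? ℤ._≟_ w (multiplicity L))} →
      ∑ℤ p (λ x → w (cell x) ℤ.* f x) ≡ cellSums f L
    ∑-weighted f w L {agree} = trans
      (∑ℤ-cong p (λ x x<p → cong (ℤ._* f x) (toWitness agree (cell<12 x<p)))) (∑-multiplicity f L)

    -- With G the indicator of a set of cells this gives distribution and reflection; with G = 1 and
    -- m a non-residue, the vanishing of the full sum.
    ∑-twist : ∀ {m} → Unit m → ∀ (G : ℕ → ℤ) →
      ∑ℤ p (λ x → G x ℤ.* χ x) ≡ χ m ℤ.* ∑ℤ p (λ x → G (mul m x) ℤ.* χ x)
    ∑-twist {m} um G = begin
      ∑ℤ p (λ x → G x ℤ.* χ x)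
        ≡⟨ ∑ℤ-reindex p (λ x → G x ℤ.* χ x) (mul< um m) (mul< um (inv m)) (mul-inverseˡ um) (mul-inverseʳ um) ⟩
      ∑ℤ p (λ x → G (mul m x) ℤ.* χ (mul m x))
        ≡⟨ ∑ℤ-cong p (λ x x<p → trans (cong (λ t → G (mul m x) ℤ.* t) (legendre-mul um x x<p)) (shuffle (G (mul m x)) (χ m) (χ x))) ⟩
      ∑ℤ p (λ x → χ m ℤ.* (G (mul m x) ℤ.* χ x))
        ≡⟨ ∑ℤ-* p (χ m) (λ x → G (mul m x) ℤ.* χ x) ⟩
      χ m ℤ.* ∑ℤ p (λ x → G (mul m x) ℤ.* χ x) ∎
      where
      open ≡-Reasoning
      shuffle : ∀ g a b → g ℤ.* (a ℤ.* b) ≡ a ℤ.* (g ℤ.* b)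
      shuffle = ℤ-Solver.solve-∀

    distribution : ∀ {m d} .{{_ : NonZero m}} .{{_ : NonZero d}} → d * m ≡ 12 → Unit m → ∀ j L L′ →
      {True (agree-below-12? ℤ._≟_ (λ c → indicator (c / m ≡ᵇ j)) (multiplicity L))} →
      {True (agree-below-12? ℤ._≟_ (λ c → indicator (c % d ≡ᵇ j)) (multiplicity L′))} →
      cellSums χ L ≡ χ m ℤ.* cellSums χ L′
    distribution {m} {d} d*m≡12 um j L L′ {agree} {agree′} = begin
      cellSums χ L
        ≡⟨ ∑-weighted χ (λ c → indicator (c / m ≡ᵇ j)) L {agree} ⟨
      ∑ℤ p (λ x → indicator (cell x / m ≡ᵇ j) ℤ.* χ x)
        ≡⟨ ∑-twist um (λ x → indicator (cell x / m ≡ᵇ j)) ⟩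
      χ m ℤ.* ∑ℤ p (λ x → indicator (cell (mul m x) / m ≡ᵇ j) ℤ.* χ x)
        ≡⟨ cong (λ t → χ m ℤ.* t) (∑ℤ-cong p (λ x _ → cong (λ c → indicator (c ≡ᵇ j) ℤ.* χ x) (cell-mul-/ d*m≡12 x))) ⟩
      χ m ℤ.* ∑ℤ p (λ x → indicator (cell x % d ≡ᵇ j) ℤ.* χ x)
        ≡⟨ cong (λ t → χ m ℤ.* t) (∑-weighted χ (λ c → indicator (c % d ≡ᵇ j)) L′ {agree′}) ⟩
      χ m ℤ.* cellSums χ L′ ∎
      where open ≡-Reasoning

    reflection : ∀ i → {True (agree-below-12? ℤ._≟_ (λ c → indicator (11 ∸ c ≡ᵇ i)) (multiplicity ((11 ∸ i) ∷ [])))} →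
      cellSum χ i ≡ χ neg ℤ.* cellSum χ (11 ∸ i)
    reflection i {agree} = begin
      cellSum χ i
        ≡⟨ ∑-twist unit-neg (λ x → indicator (cell x ≡ᵇ i)) ⟩
      χ neg ℤ.* ∑ℤ p (λ x → indicator (cell (mul neg x) ≡ᵇ i) ℤ.* χ x)
        ≡⟨ cong (λ t → χ neg ℤ.* t) (∑ℤ-cong p reflect) ⟩
      χ neg ℤ.* ∑ℤ p (λ x → indicator (11 ∸ cell x ≡ᵇ i) ℤ.* χ x)
        ≡⟨ cong (λ t → χ neg ℤ.* t) (∑-weighted χ (λ c → indicator (11 ∸ c ≡ᵇ i)) ((11 ∸ i) ∷ []) {agree}) ⟩
      χ neg ℤ.* (cellSum χ (11 ∸ i) ℤ.+ 0ℤ)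
        ≡⟨ cong (λ t → χ neg ℤ.* t) (ℤ.+-identityʳ (cellSum χ (11 ∸ i))) ⟩
      χ neg ℤ.* cellSum χ (11 ∸ i) ∎
      where
      open ≡-Reasoning
      χ0≡0 : χ 0 ≡ 0ℤ
      χ0≡0 = legendre-0 0%p≡0
      reflect : ∀ x → x < p → indicator (cell (mul neg x) ≡ᵇ i) ℤ.* χ x ≡ indicator (11 ∸ cell x ≡ᵇ i) ℤ.* χ x
      -- Negation leaves 0 in cell 0 and does not move it to cell 11; the term disappears because
      -- χ(0) = 0.
      reflect zero    _   rewrite χ0≡0 = trans (ℤ.*-zeroʳ (indicator (cell (mul neg 0) ≡ᵇ i))) (sym (ℤ.*-zeroʳ (indicator (11 ∸ cell 0 ≡ᵇ i))))
      reflect (suc x) x<p = cong (λ c → indicator (c ≡ᵇ i) ℤ.* χ (suc x)) (cell-neg x x<p)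

    isUnit isNonresidue : ℕ → ℤ
    isUnit x = indicator (nonzero x)
    isNonresidue x = indicator (isNonResB p x)

    legendre-split : ∀ x → x < p → χ x ≡ isUnit x ℤ.- + 2 ℤ.* isNonresidue x
    legendre-split zero _ rewrite dec-true (p ∣? 0) (p ∣0) = refl
    legendre-split x@(suc _) x<p with classify x (≢0⇒Unit x<p λ ())
    ... | residue χx nx _    rewrite χx | nx = refl
    ... | nonresidue χx nx _ rewrite χx | nx = refl

    size : ℕ → ℕ
    size i = count p (band i (suc i))

    sizes : List ℕ → ℕ
    sizes L = List.sum (map size L)

    size-≡ : ∀ i x → band i (suc i) x ≡ (nonzero x ∧ (cell x ≡ᵇ i))
    size-≡ i x = cong (nonzero x ∧_) (between i (cell x))
      where
      between : ∀ i c → ((i ≤ᵇ c) ∧ (c <ᵇ suc i)) ≡ (c ≡ᵇ i)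
      between zero          zero    = refl
      between zero          (suc c) = refl
      between (suc i)       zero    = refl
      between (suc zero)    (suc c) = between zero c
      between (suc (suc i)) (suc c) = between (suc i) c

    cellSum-legendre : ∀ i → cellSum χ i ≡ + size i ℤ.- + 2 ℤ.* cellSum isNonresidue i
    cellSum-legendre i = begin
      cellSum χ i
        ≡⟨ ∑ℤ-cong p (λ x x<p → trans (cong (λ t → indicator (cell x ≡ᵇ i) ℤ.* t) (legendre-split x x<p))
             (cases (nonzero x) (cell x ≡ᵇ i) (isNonresidue x))) ⟩
      ∑ℤ p (λ x → + ((nonzero x ∧ (cell x ≡ᵇ i)) ⇒ℕ 1) ℤ.+ (- + 2) ℤ.* (indicator (cell x ≡ᵇ i) ℤ.* isNonresidue x))
        ≡⟨ ∑ℤ-+ p (λ x → + ((nonzero x ∧ (cell x ≡ᵇ i)) ⇒ℕ 1)) (λ x → (- + 2) ℤ.* (indicator (cell x ≡ᵇ i) ℤ.* isNonresidue x)) ⟩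
      ∑ℤ p (λ x → + ((nonzero x ∧ (cell x ≡ᵇ i)) ⇒ℕ 1)) ℤ.+ ∑ℤ p (λ x → (- + 2) ℤ.* (indicator (cell x ≡ᵇ i) ℤ.* isNonresidue x))
        ≡⟨ cong₂ ℤ._+_
             (trans (∑ℤ-pos p (λ x → (nonzero x ∧ (cell x ≡ᵇ i)) ⇒ℕ 1)) (cong +_ (∑ℕ-cong p λ x _ → cong (_⇒ℕ 1) (sym (size-≡ i x)))))
             (∑ℤ-* p (- + 2) (λ x → indicator (cell x ≡ᵇ i) ℤ.* isNonresidue x)) ⟩
      + size i ℤ.+ (- + 2) ℤ.* cellSum isNonresidue i
        ≡⟨ cong (λ t → + size i ℤ.+ t) (sym (ℤ.neg-distribˡ-* (+ 2) (cellSum isNonresidue i))) ⟩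
      + size i ℤ.- + 2 ℤ.* cellSum isNonresidue i ∎
      where
      open ≡-Reasoning
      cases : ∀ z e n → indicator e ℤ.* (indicator z ℤ.- + 2 ℤ.* n)
        ≡ + ((z ∧ e) ⇒ℕ 1) ℤ.+ (- + 2) ℤ.* (indicator e ℤ.* n)
      cases false false n = refl
      cases false true  n = lemma n
        where
        lemma : ∀ n → + 1 ℤ.* (+ 0 ℤ.- + 2 ℤ.* n) ≡ + 0 ℤ.+ (- + 2) ℤ.* (+ 1 ℤ.* n)
        lemma = ℤ-Solver.solve-∀
      cases true  false n = refl
      cases true  true  n = lemma n
        where
        lemma : ∀ n → + 1 ℤ.* (+ 1 ℤ.- + 2 ℤ.* n) ≡ + 1 ℤ.+ (- + 2) ℤ.* (+ 1 ℤ.* n)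
        lemma = ℤ-Solver.solve-∀

    cellSums-legendre : ∀ L → cellSums χ L ≡ + sizes L ℤ.- + 2 ℤ.* cellSums isNonresidue L
    cellSums-legendre []      = refl
    cellSums-legendre (i ∷ L) = trans (cong₂ ℤ._+_ (cellSum-legendre i) (cellSums-legendre L))
      (trans (collect (+ size i) (cellSum isNonresidue i) (+ sizes L) (cellSums isNonresidue L))
        (cong (λ t → t ℤ.- + 2 ℤ.* (cellSum isNonresidue i ℤ.+ cellSums isNonresidue L)) (sym (ℤ.pos-+ (size i) (sizes L)))))
      where
      collect : ∀ a n b m → (a ℤ.- + 2 ℤ.* n) ℤ.+ (b ℤ.- + 2 ℤ.* m) ≡ (a ℤ.+ b) ℤ.- + 2 ℤ.* (n ℤ.+ m)
      collect = ℤ-Solver.solve-∀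

    module Sizes (r k : ℕ) (p≡ : p ≡ r + 24 * k) where
      -- Since 24k = 12 · 2k, a cell holds 2k units more than the same cell for r. The rest,
      -- `excess`, depends on r alone and evaluates for a literal r.
      /12 : ∀ i → i * p / 12 ≡ i * r / 12 + i * (2 * k)
      /12 i = begin
        i * p / 12                          ≡⟨ /-congˡ {o = 12} (trans (cong (i *_) p≡) (expand i r k)) ⟩
        (i * r + i * (2 * k) * 12) / 12     ≡⟨ +-distrib-/-∣ʳ (i * r) (n∣m*n (i * (2 * k))) ⟩
        i * r / 12 + i * (2 * k) * 12 / 12  ≡⟨ cong (λ t → i * r / 12 + t) (m*n/n≡m (i * (2 * k)) 12) ⟩
        i * r / 12 + i * (2 * k)            ∎
        where
        open ≡-Reasoning
        expand : ∀ i r k → i * (r + 24 * k) ≡ i * r + i * (2 * k) * 12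
        expand = solve-∀

      count-band-≡ : ∀ i j → i ≤ j → j < 12 → count p (band i j) ≡ (j * r / 12 ∸ i * r / 12) + (j ∸ i) * (2 * k)
      count-band-≡ i j i≤j j<12 = +-cancelʳ-≡ (i * p / 12) _ _ (begin
        count p (band i j) + i * p / 12         ≡⟨ count-band i≤j j<12 ⟩
        j * p / 12                              ≡⟨ /12 j ⟩
        j * r / 12 + j * (2 * k)
          ≡⟨ cong₂ (λ a b → a + b * (2 * k)) (m∸n+n≡m (/-monoˡ-≤ 12 (*-monoˡ-≤ r i≤j))) (m∸n+n≡m i≤j) ⟨
        (δ + i * r / 12) + (j ∸ i + i) * (2 * k)     ≡⟨ shuffle δ (i * r / 12) (j ∸ i) i (2 * k) ⟩
        δ + (j ∸ i) * (2 * k) + (i * r / 12 + i * (2 * k))  ≡⟨ cong (λ t → δ + (j ∸ i) * (2 * k) + t) (/12 i) ⟨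
        δ + (j ∸ i) * (2 * k) + i * p / 12      ∎)
        where
        open ≡-Reasoning
        δ = j * r / 12 ∸ i * r / 12
        shuffle : ∀ d q m i k → (d + q) + (m + i) * k ≡ d + m * k + (q + i * k)
        shuffle = solve-∀

      excess : ℕ → ℕ
      excess i = suc i * r / 12 ∸ i * r / 12

      size-formula : ∀ i → i < 11 → size i ≡ excess i + 2 * k
      size-formula i i<11 = trans (count-band-≡ i (suc i) (n≤1+n i) (s≤s i<11))
        (cong (λ t → excess i + t) (trans (cong (_* (2 * k)) (m+n∸n≡m 1 i)) (*-identityˡ (2 * k))))

      sizes-formula : ∀ L {_ : True (all? (_<? 11) L)} → + sizes L ≡ + List.sum (map excess L) ℤ.+ + length L ℤ.* (+ 2 ℤ.* + k)
      sizes-formula L {t} = go L (toWitness t)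
        where
        go : ∀ L → All (_< 11) L → + sizes L ≡ + List.sum (map excess L) ℤ.+ + length L ℤ.* (+ 2 ℤ.* + k)
        go []      All.[]         = refl
        go (i ∷ L) (i< All.∷ L<) = begin
          + (size i + sizes L)      ≡⟨ ℤ.pos-+ (size i) (sizes L) ⟩
          + size i ℤ.+ + sizes L    ≡⟨ cong₂ ℤ._+_ (trans (cong +_ (size-formula i i<)) (trans (ℤ.pos-+ (excess i) (2 * k)) (cong (λ t → + excess i ℤ.+ t) (ℤ.pos-* 2 k)))) (go L L<) ⟩
          (+ excess i ℤ.+ + 2 ℤ.* + k) ℤ.+ (+ rest ℤ.+ + length L ℤ.* (+ 2 ℤ.* + k))
            ≡⟨ collect (+ excess i) (+ 2 ℤ.* + k) (+ rest) (+ length L) ⟩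
          (+ excess i ℤ.+ + rest) ℤ.+ (+ 1 ℤ.+ + length L) ℤ.* (+ 2 ℤ.* + k)
            ≡⟨ cong₂ (λ a b → a ℤ.+ b ℤ.* (+ 2 ℤ.* + k)) (sym (ℤ.pos-+ (excess i) rest)) (sym (ℤ.pos-+ 1 (length L))) ⟩
          + (excess i + rest) ℤ.+ + suc (length L) ℤ.* (+ 2 ℤ.* + k) ∎
          where
          open ≡-Reasoning
          rest = List.sum (map excess L)
          collect : ∀ a k b l → (a ℤ.+ k) ℤ.+ (b ℤ.+ l ℤ.* k) ≡ (a ℤ.+ b) ℤ.+ (+ 1 ℤ.+ l) ℤ.* k
          collect = ℤ-Solver.solve-∀

      cellSums-≡ : ∀ L {_ : True (all? (_<? 11) L)} →
        cellSums χ L ≡ (+ List.sum (map excess L) ℤ.+ + length L ℤ.* (+ 2 ℤ.* + k)) ℤ.- + 2 ℤ.* cellSums isNonresidue L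
      cellSums-≡ L {t} = trans (cellSums-legendre L) (cong (λ c → c ℤ.- + 2 ℤ.* cellSums isNonresidue L) (sizes-formula L {t}))

  open CellSums

  -- Intervals, counts of non-residues and Legendre products in terms of cells.

  module Counting where
    module _ {d e : ℕ} (d*e≡12 : d * e ≡ 12) (n : ℕ) where
      private
        scale : ∀ x → d * x * e ≡ 12 * x
        scale x = trans (swap d x e) (cong (_* x) d*e≡12)
          where
          swap : ∀ d x e → d * x * e ≡ d * e * x
          swap = solve-∀
        scale′ : n * p * e ≡ n * e * p
        scale′ = swap n p e
          where
          swap : ∀ n p e → n * p * e ≡ n * e * p
          swap = solve-∀
        ≤-cell : ∀ {x} → n * p ≤ d * x → n * e ≤ cell x
        ≤-cell {x} le = subst (_≤ cell x) (m*n/n≡m (n * e) p)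
          (/-monoˡ-≤ p (subst₂ _≤_ scale′ (scale x) (*-monoˡ-≤ e le)))
        cell-< : ∀ {x} → d * x < n * p → cell x < n * e
        cell-< {x} lt = m<n*o⇒m/o<n {n = n * e} (subst₂ _<_ (scale x) scale′ (*-monoˡ-< e {{e≢0}} lt))
          where
          e≢0 : NonZero e
          e≢0 = m*n≢0⇒n≢0 d {e} {{subst NonZero (sym d*e≡12) _}}

      upper-bound : ∀ x → (d * x <ᵇ n * p) ≡ (cell x <ᵇ n * e)
      upper-bound x = T-ext (λ t → <⇒<ᵇ (cell-< (<ᵇ⇒< (d * x) (n * p) t)))
        (λ t → <⇒<ᵇ (≰⇒> λ le → <⇒≱ (<ᵇ⇒< (cell x) (n * e) t) (≤-cell le)))

      -- The strict comparison becomes a weak one between cells because a unit cannot equal the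
      -- endpoint np/d: otherwise p would divide 12x.
      lower-bound : ∀ {x} → Unit x → (n * p <ᵇ d * x) ≡ (n * e ≤ᵇ cell x)
      lower-bound {x} ux = T-ext (λ t → ≤⇒≤ᵇ (≤-cell (<⇒≤ (<ᵇ⇒< (n * p) (d * x) t))))
        (λ t → <⇒<ᵇ (≤∧≢⇒< (≮⇒≥ λ lt → <⇒≱ (cell-< lt) (≤ᵇ⇒≤ (n * e) (cell x) t))
          λ eq → Unit-* {12} {x} unit-12 ux (trans (cong (_% p) (trans (sym (scale x)) (cong (_* e) (sym eq))))
            (trans (cong (_% p) scale′) (m*n%n≡0 (n * e) p)))))

    inIntB-cell : ∀ n₁ d₁ e₁ n₂ d₂ e₂ → d₁ * e₁ ≡ 12 → d₂ * e₂ ≡ 12 → ∀ {x} → Unit x →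
      inIntB p n₁ d₁ n₂ d₂ x ≡ ((n₁ * e₁ ≤ᵇ cell x) ∧ (cell x <ᵇ n₂ * e₂))
    inIntB-cell n₁ d₁ e₁ n₂ d₂ e₂ eq₁ eq₂ {x} ux = cong₂ _∧_ (lower-bound {d₁} {e₁} eq₁ n₁ ux) (upper-bound {d₂} {e₂} eq₂ n₂ x)

    isNonResB-0 : isNonResB p 0 ≡ false
    isNonResB-0 rewrite dec-true (p ∣? 0) (p ∣0) = refl

    count-nonresidues : ∀ (b w : ℕ → Bool) L → (∀ {x} → Unit x → b x ≡ w (cell x)) →
      {True (agree-below-12? ℤ._≟_ (indicator ∘ w) (multiplicity L))} →
      + count p (λ x → b x ∧ isNonResB p x) ≡ cellSums isNonresidue L
    count-nonresidues b w L b≡w {agree} = begin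
      + count p (λ x → b x ∧ isNonResB p x)
        ≡⟨ ∑ℤ-pos p (λ x → (b x ∧ isNonResB p x) ⇒ℕ 1) ⟨
      ∑ℤ p (λ x → + ((b x ∧ isNonResB p x) ⇒ℕ 1))
        ≡⟨ ∑ℤ-cong p pointwise ⟩
      ∑ℤ p (λ x → indicator (w (cell x)) ℤ.* isNonresidue x)
        ≡⟨ ∑-weighted isNonresidue (indicator ∘ w) L {agree} ⟩
      cellSums isNonresidue L ∎
      where
      open ≡-Reasoning
      cases : ∀ b n → + ((b ∧ n) ⇒ℕ 1) ≡ indicator b ℤ.* indicator n
      cases false n     = refl
      cases true  false = refl
      cases true  true  = refl
      pointwise : ∀ x → x < p → + ((b x ∧ isNonResB p x) ⇒ℕ 1) ≡ indicator (w (cell x)) ℤ.* isNonresidue x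
      -- At 0 the interval test and the cell test may disagree, but 0 is not a non-residue.
      pointwise zero      _   = trans (cong (λ n → + ((b 0 ∧ n) ⇒ℕ 1)) isNonResB-0)
        (trans (cong (λ t → + (t ⇒ℕ 1)) (Bool.∧-zeroʳ (b 0)))
        (sym (trans (cong (λ n → indicator (w (cell 0)) ℤ.* indicator n) isNonResB-0) (ℤ.*-zeroʳ (indicator (w (cell 0)))))))
      pointwise x@(suc _) x<p = trans (cases (b x) (isNonResB p x))
        (cong (λ b → indicator b ℤ.* isNonresidue x) (b≡w (≢0⇒Unit x<p λ ())))

    numN6-cells : + numN6 p ≡ cellSums isNonresidue (1 ∷ 3 ∷ 5 ∷ [])
    numN6-cells = trans (cong +_ (length-filter (λ x → inUnion6B p x ∧ isNonResB p x) id p))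
      (count-nonresidues (inUnion6B p)
        (λ c → ((1 ≤ᵇ c) ∧ (c <ᵇ 2)) ∨ ((3 ≤ᵇ c) ∧ (c <ᵇ 4)) ∨ ((5 ≤ᵇ c) ∧ (c <ᵇ 6))) (1 ∷ 3 ∷ 5 ∷ [])
        (λ u → cong₂ _∨_ (inIntB-cell 1 12 1 1 6 2 refl refl u)
          (cong₂ _∨_ (inIntB-cell 1 4 3 1 3 4 refl refl u) (inIntB-cell 5 12 1 1 2 6 refl refl u))))

    foldr-legendre : ∀ (b : ℕ → Bool) → (∀ x → b x ≡ true → Unit x) → ∀ xs →
      foldr ℤ._*_ (+ 1) (map χ (filterᵇ b xs)) ≡ sgn (length (filterᵇ (λ x → b x ∧ isNonResB p x) xs))
    foldr-legendre b unit []       = refl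
    foldr-legendre b unit (x ∷ xs) with b x in eq
    ... | false = foldr-legendre b unit xs
    ... | true with classify x (unit x eq)
    ...   | residue χx nx _    rewrite nx | χx = trans (ℤ.*-identityˡ _) (foldr-legendre b unit xs)
    ...   | nonresidue χx nx _ rewrite nx | χx = cong ((- (+ 1)) ℤ.*_) (foldr-legendre b unit xs)

    inIntB-unit : ∀ n₁ d₁ d₂ .{{_ : NonZero d₂}} x → inIntB p n₁ d₁ 1 d₂ x ≡ true → Unit x
    inIntB-unit n₁ d₁ d₂ x e = ≢0⇒Unit (≤-<-trans (m≤n*m x d₂) d₂x<p) x≢0
      where
      t : T (n₁ * p <ᵇ d₁ * x) × T (d₂ * x <ᵇ 1 * p)
      t = Equivalence.to Bool.T-∧ (subst T (sym e) _)
      d₂x<p : d₂ * x < p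
      d₂x<p = subst (d₂ * x <_) (*-identityˡ p) (<ᵇ⇒< (d₂ * x) (1 * p) (proj₂ t))
      x≢0 : x ≢ 0
      x≢0 refl = contradiction (subst (n₁ * p <_) (*-zeroʳ d₁) (<ᵇ⇒< (n₁ * p) (d₁ * 0) (proj₁ t))) λ ()

    prodLeg-count : ∀ n₁ d₁ d₂ .{{_ : NonZero d₂}} →
      prodLeg p n₁ d₁ 1 d₂ ≡ sgn (count p (λ x → inIntB p n₁ d₁ 1 d₂ x ∧ isNonResB p x))
    prodLeg-count n₁ d₁ d₂ = begin
      prodLeg p n₁ d₁ 1 d₂
        ≡⟨ foldr-legendre b (inIntB-unit n₁ d₁ d₂) (upTo (suc (1 * p))) ⟩
      sgn (length (filterᵇ (λ x → b x ∧ isNonResB p x) (upTo (suc (1 * p)))))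
        ≡⟨ cong sgn (length-filter (λ x → b x ∧ isNonResB p x) id (suc (1 * p))) ⟩
      sgn (count (suc (1 * p)) (λ x → b x ∧ isNonResB p x))
        ≡⟨ cong (λ n → sgn (count (suc n) (λ x → b x ∧ isNonResB p x))) (*-identityˡ p) ⟩
      -- The product also enumerates p itself; it falls outside the interval, which contains only
      -- units.
      sgn (count (suc p) (λ x → b x ∧ isNonResB p x))
        ≡⟨ cong sgn (count-suc p (λ x → b x ∧ isNonResB p x)) ⟩
      sgn (count p (λ x → b x ∧ isNonResB p x) + ((b p ∧ isNonResB p p) ⇒ℕ 1))
        ≡⟨ cong sgn (trans (cong (λ t → count p (λ x → b x ∧ isNonResB p x) + ((t ∧ isNonResB p p) ⇒ℕ 1)) bp≡false) (+-identityʳ _)) ⟩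
      sgn (count p (λ x → b x ∧ isNonResB p x)) ∎
      where
      open ≡-Reasoning
      b = inIntB p n₁ d₁ 1 d₂
      bp≡false : b p ≡ false
      bp≡false = Bool.¬-not (λ e → inIntB-unit n₁ d₁ d₂ p e (n%n≡0 p))

  open Counting

  -- The values χ(-1), χ(2), χ(3) and the residue classes modulo 24.

  module Cases where
    legendre-neg-1mod4 : p % 4 ≡ 1 → χ neg ≡ 1ℤ
    legendre-neg-1mod4 e = legendre-1 unit-neg (trans (cong (λ n → neg ^ n % p) h≡) (neg^even≈1 (p / 4)))
      where
      h≡ : h ≡ 2 * (p / 4)
      h≡ = *-cancelʳ-≡ h (2 * (p / 4)) 2 (trans (sym neg≡h*2) (trans
        (suc-injective (trans (sym p≡1+neg) (trans (m≡m%n+[m/n]*n p 4) (cong (_+ p / 4 * 4) e)))) (double (p / 4))))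
        where
        double : ∀ q → q * 4 ≡ 2 * q * 2
        double = solve-∀

    legendre-neg-3mod4 : p % 4 ≡ 3 → χ neg ≡ -1ℤ
    legendre-neg-3mod4 e = legendre-neg1 unit-neg (trans (cong (λ n → neg ^ n % p) h≡)
      (trans (*-congˡ-≈ neg (neg^even≈1 (p / 4))) (cong (_% p) (*-identityʳ neg))))
      where
      h≡ : h ≡ suc (2 * (p / 4))
      h≡ = *-cancelʳ-≡ h (suc (2 * (p / 4))) 2 (trans (sym neg≡h*2) (trans
        (suc-injective (trans (sym p≡1+neg) (trans (m≡m%n+[m/n]*n p 4) (cong (_+ p / 4 * 4) e)))) (double (p / 4))))
        where
        double : ∀ q → 2 + q * 4 ≡ suc (2 * q) * 2
        double = solve-∀

    legendre-±1 : ∀ {x} → Unit x → χ x ≡ 1ℤ ⊎ χ x ≡ -1ℤ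
    legendre-±1 {x} u with classify x u
    ... | residue χx _ _    = inj₁ χx
    ... | nonresidue χx _ _ = inj₂ χx

    s n : ℕ → ℤ
    s = cellSum χ
    n = cellSum isNonresidue

    N₁₃₅ : ℤ
    N₁₃₅ = cellSums isNonresidue (1 ∷ 3 ∷ 5 ∷ [])

    module Distribution {a b e : ℤ} (χ2≡a : χ 2 ≡ a) (χ3≡b : χ 3 ≡ b) (χneg≡e : χ neg ≡ e) where
      -- The cell l is to lie in the upper half; its mirror image replaces it, so that only s₀, ...,
      -- s₅ occur. The same is done for m in `tripling`.
      doubling : ∀ i j k l →
        cellSums χ (i ∷ j ∷ []) ≡ χ 2 ℤ.* cellSums χ (k ∷ l ∷ []) → s l ≡ χ neg ℤ.* s (11 ∸ l) →
        s i ℤ.+ s j ≡ a ℤ.* (s k ℤ.+ e ℤ.* s (11 ∸ l))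
      doubling i j k l eq mirror = trans (cong (λ t → s i ℤ.+ t) (sym (ℤ.+-identityʳ (s j))))
        (trans eq (cong₂ (λ a t → a ℤ.* (s k ℤ.+ t)) χ2≡a
          (trans (ℤ.+-identityʳ (s l)) (trans mirror (cong (ℤ._* s (11 ∸ l)) χneg≡e)))))

      tripling : ∀ h i j k l m →
        cellSums χ (h ∷ i ∷ j ∷ []) ≡ χ 3 ℤ.* cellSums χ (k ∷ l ∷ m ∷ []) → s m ≡ χ neg ℤ.* s (11 ∸ m) →
        s h ℤ.+ s i ℤ.+ s j ≡ b ℤ.* (s k ℤ.+ s l ℤ.+ e ℤ.* s (11 ∸ m))
      tripling h i j k l m eq mirror = trans (assoc (s h) (s i) (s j)) (trans eq (cong₂ ℤ._*_ χ3≡b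
        (trans (sym (assoc (s k) (s l) (s m))) (cong (λ t → s k ℤ.+ s l ℤ.+ t) (trans mirror (cong (ℤ._* s (11 ∸ m)) χneg≡e))))))
        where
        assoc : ∀ x y z → x ℤ.+ y ℤ.+ z ≡ x ℤ.+ (y ℤ.+ (z ℤ.+ 0ℤ))
        assoc = ℤ-Solver.solve-∀

      doubling-0 : s 0 ℤ.+ s 1 ≡ a ℤ.* (s 0 ℤ.+ e ℤ.* s 5)
      doubling-0 = doubling 0 1 0 6 (distribution {2} {6} refl unit-2 0 (0 ∷ 1 ∷ []) (0 ∷ 6 ∷ [])) (reflection 6)

      doubling-1 : s 2 ℤ.+ s 3 ≡ a ℤ.* (s 1 ℤ.+ e ℤ.* s 4)
      doubling-1 = doubling 2 3 1 7 (distribution {2} {6} refl unit-2 1 (2 ∷ 3 ∷ []) (1 ∷ 7 ∷ [])) (reflection 7)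

      doubling-2 : s 4 ℤ.+ s 5 ≡ a ℤ.* (s 2 ℤ.+ e ℤ.* s 3)
      doubling-2 = doubling 4 5 2 8 (distribution {2} {6} refl unit-2 2 (4 ∷ 5 ∷ []) (2 ∷ 8 ∷ [])) (reflection 8)

      tripling-0 : s 0 ℤ.+ s 1 ℤ.+ s 2 ≡ b ℤ.* (s 0 ℤ.+ s 4 ℤ.+ e ℤ.* s 3)
      tripling-0 = tripling 0 1 2 0 4 8 (distribution {3} {4} refl unit-3 0 (0 ∷ 1 ∷ 2 ∷ []) (0 ∷ 4 ∷ 8 ∷ [])) (reflection 8)

      tripling-1 : s 3 ℤ.+ s 4 ℤ.+ s 5 ≡ b ℤ.* (s 1 ℤ.+ s 5 ℤ.+ e ℤ.* s 2)
      tripling-1 = tripling 3 4 5 1 5 9 (distribution {3} {4} refl unit-3 1 (3 ∷ 4 ∷ 5 ∷ []) (1 ∷ 5 ∷ 9 ∷ [])) (reflection 9)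

    prodLeg-cells : ∀ n₁ d₁ e₁ d₂ e₂ .{{_ : NonZero d₂}} → d₁ * e₁ ≡ 12 → d₂ * e₂ ≡ 12 → ∀ L →
      {True (agree-below-12? ℤ._≟_ (λ c → indicator ((n₁ * e₁ ≤ᵇ c) ∧ (c <ᵇ 1 * e₂))) (multiplicity L))} →
      ∃ λ m → prodLeg p n₁ d₁ 1 d₂ ≡ sgn m × + m ≡ cellSums isNonresidue L
    prodLeg-cells n₁ d₁ e₁ d₂ e₂ eq₁ eq₂ L {agree} = _ , prodLeg-count n₁ d₁ d₂ ,
      count-nonresidues (inIntB p n₁ d₁ 1 d₂) (λ c → (n₁ * e₁ ≤ᵇ c) ∧ (c <ᵇ 1 * e₂)) L
        (inIntB-cell n₁ d₁ e₁ 1 d₂ e₂ eq₁ eq₂) {agree}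

    third : ∃ λ m → prodLeg p 1 4 1 3 ≡ sgn m × + m ≡ cellSums isNonresidue (3 ∷ [])
    third = prodLeg-cells 1 4 3 3 4 refl refl (3 ∷ [])

    zeroth : ∃ λ m → prodLeg p 0 1 1 12 ≡ sgn m × + m ≡ cellSums isNonresidue (0 ∷ [])
    zeroth = prodLeg-cells 0 1 12 12 1 refl refl (0 ∷ [])

    half : ∃ λ m → prodLeg p 0 1 1 2 ≡ sgn m × + m ≡ cellSums isNonresidue (0 ∷ 1 ∷ 2 ∷ 3 ∷ 4 ∷ 5 ∷ [])
    half = prodLeg-cells 0 1 12 2 6 refl refl (0 ∷ 1 ∷ 2 ∷ 3 ∷ 4 ∷ 5 ∷ [])

    sgn-numN6 : ∀ {m x} z → + m ≡ x → N₁₃₅ ≡ x ℤ.+ + 2 ℤ.* z → sgn (numN6 p) ≡ sgn m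
    sgn-numN6 {m} z m≡x eq = sgn-mod2 z (trans numN6-cells (trans eq (cong (ℤ._+ + 2 ℤ.* z) (sym m≡x))))

    sgn-numN6-* : ∀ c {q x} → (∃ λ m → q ≡ sgn m × + m ≡ x) → ∀ z →
      N₁₃₅ ≡ (+ c ℤ.+ x) ℤ.+ + 2 ℤ.* z → sgn (numN6 p) ≡ sgn c ℤ.* q
    sgn-numN6-* c (m , q≡ , m≡x) z eq = trans (sgn-numN6 {c + m} z (trans (ℤ.pos-+ c m) (cong (λ t → + c ℤ.+ t) m≡x)) eq)
      (trans (sgn-+ c m) (cong (sgn c ℤ.*_) (sym q≡)))

    sgn-numN6-≡ : ∀ {q x} → (∃ λ m → q ≡ sgn m × + m ≡ x) → ∀ z →
      N₁₃₅ ≡ x ℤ.+ + 2 ℤ.* z → sgn (numN6 p) ≡ q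
    sgn-numN6-≡ (m , q≡ , m≡x) z eq = trans (sgn-numN6 {m} z m≡x eq) (sym q≡)

    module Residue (r k : ℕ) (p≡ : p ≡ r + 24 * k) where
      open Sizes r k p≡

      %4 : p % 4 ≡ r % 4
      %4 = trans (cong (_% 4) (trans p≡ (cong (λ t → r + t) (shuffle k)))) ([m+kn]%n≡m%n r (6 * k) 4)
        where
        shuffle : ∀ k → 24 * k ≡ 6 * k * 4
        shuffle = solve-∀

      -- An odd number of terms ±1 has an odd sum, and every cell adds only the even number 2k to
      -- its excess.
      nonvanishing : ∀ L {_ : True (all? (_<? 11) L)} m → List.sum (map excess L) ≡ 1 + 2 * m → cellSums χ L ≢ 0ℤ
      nonvanishing L {t} m odd eq = odd≢even 0 {z}
        (rearrange (+ List.sum (map excess L)) (+ m) (+ length L) (+ k) (cellSums isNonresidue L)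
          (trans (sym (cellSums-≡ L {t})) eq)
          (trans (cong +_ odd) (trans (ℤ.pos-+ 1 (2 * m)) (cong (λ t → + 1 ℤ.+ t) (ℤ.pos-* 2 m)))))
        where
        z = cellSums isNonresidue L ℤ.- + m ℤ.- + length L ℤ.* + k
        rearrange : ∀ c m l k x → (c ℤ.+ l ℤ.* (+ 2 ℤ.* k)) ℤ.- + 2 ℤ.* x ≡ 0ℤ → c ≡ + 1 ℤ.+ + 2 ℤ.* m →
          + 1 ≡ + 2 ℤ.* (x ℤ.- m ℤ.- l ℤ.* k)
        rearrange c m l k x e f = add-multiple (+ 1) e (add-multiple (- + 1) f (ℤ-Solver.solve (c ∷ m ∷ l ∷ k ∷ x ∷ [])))

      module Mod3 (3mod4 : p % 4 ≡ 3) where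
        χneg : χ neg ≡ -1ℤ
        χneg = legendre-neg-3mod4 3mod4

        -- The value -1 would make χ sum to zero over cells that hold an odd number of units. The
        -- argument m only witnesses the oddness; for a literal r it is a numeral. The next three
        -- work alike.
        χ2≡1 : ∀ m → List.sum (map excess (0 ∷ 1 ∷ 2 ∷ [])) ≡ 1 + 2 * m → χ 2 ≡ 1ℤ
        χ2≡1 m odd with legendre-±1 unit-2
        ... | inj₁ e = e
        ... | inj₂ e = contradiction (χ2≡-1⇒ {s 0} {s 1} {s 2} {s 3} {s 4} {s 5} doubling-0 doubling-1 doubling-2) (nonvanishing (0 ∷ 1 ∷ 2 ∷ []) m odd)
          where open Distribution e refl χneg

        χ2≡-1 : ∀ m → List.sum (map excess (3 ∷ 4 ∷ 5 ∷ [])) ≡ 1 + 2 * m → χ 2 ≡ -1ℤ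
        χ2≡-1 m odd with legendre-±1 unit-2
        ... | inj₂ e = e
        ... | inj₁ e = contradiction (χ2≡1⇒ {s 0} {s 1} {s 2} {s 3} {s 4} {s 5} doubling-0 doubling-1 doubling-2) (nonvanishing (3 ∷ 4 ∷ 5 ∷ []) m odd)
          where open Distribution e refl χneg

        χ3≡1 : ∀ m → List.sum (map excess (0 ∷ 1 ∷ 4 ∷ 5 ∷ [])) ≡ 1 + 2 * m → χ 3 ≡ 1ℤ
        χ3≡1 m odd with legendre-±1 unit-3
        ... | inj₁ e = e
        ... | inj₂ e = contradiction (χ3≡-1⇒ {s 0} {s 1} {s 2} {s 3} {s 4} {s 5} tripling-0 tripling-1) (nonvanishing (0 ∷ 1 ∷ 4 ∷ 5 ∷ []) m odd)
          where open Distribution refl e χneg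

        χ3≡-1 : ∀ m → List.sum (map excess (2 ∷ 3 ∷ [])) ≡ 1 + 2 * m → χ 3 ≡ -1ℤ
        χ3≡-1 m odd with legendre-±1 unit-3
        ... | inj₂ e = e
        ... | inj₁ e = contradiction (χ3≡1⇒ {s 0} {s 1} {s 2} {s 3} {s 4} {s 5} tripling-0 tripling-1) (nonvanishing (2 ∷ 3 ∷ []) m odd)
          where open Distribution refl e χneg

      module _ (excess₅≡excess₁ : excess 5 ≡ excess 1) where
        size₀ : cellSums χ (0 ∷ []) ≡ (+ (excess 0 + 0) ℤ.+ + 1 ℤ.* (+ 2 ℤ.* + k)) ℤ.- + 2 ℤ.* cellSums isNonresidue (0 ∷ [])
        size₀ = cellSums-≡ (0 ∷ [])

        size₁ : cellSums χ (1 ∷ []) ≡ (+ (excess 1 + 0) ℤ.+ + 1 ℤ.* (+ 2 ℤ.* + k)) ℤ.- + 2 ℤ.* cellSums isNonresidue (1 ∷ [])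
        size₁ = cellSums-≡ (1 ∷ [])

        size₅ : cellSums χ (5 ∷ []) ≡ (+ (excess 1 + 0) ℤ.+ + 1 ℤ.* (+ 2 ℤ.* + k)) ℤ.- + 2 ℤ.* cellSums isNonresidue (5 ∷ [])
        size₅ = subst (λ d → cellSums χ (5 ∷ []) ≡ (+ (d + 0) ℤ.+ + 1 ℤ.* (+ 2 ℤ.* + k)) ℤ.- + 2 ℤ.* cellSums isNonresidue (5 ∷ []))
          excess₅≡excess₁ (cellSums-≡ (5 ∷ []))

        third-1mod4 : p % 4 ≡ 1 → excess 0 ≡ excess 1 → sgn (numN6 p) ≡ prodLeg p 1 4 1 3
        third-1mod4 1mod4 excess₀≡excess₁ with legendre-±1 unit-2
        ... | inj₁ χ2≡1 = sgn-numN6-≡ third (n 1) (even-χ2≡1 {s 0} {s 1} {s 5} {+ k} {+ (excess 0 + 0)} {+ (excess 1 + 0)} {n 0} {n 1} {n 3} {n 5} size₀ size₁ size₅ doubling-0)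
          where open Distribution χ2≡1 refl (legendre-neg-1mod4 1mod4)
        ... | inj₂ χ2≡-1 = sgn-numN6-≡ third (+ (excess 0 + 0) ℤ.+ + 2 ℤ.* + k ℤ.- n 0)
            (even-χ2≡-1 {s 0} {s 1} {s 5} {+ k} {+ (excess 0 + 0)} {+ (excess 1 + 0)} {n 0} {n 1} {n 3} {n 5} size₀ size₁ size₅ (cong (λ d → + (d + 0)) excess₀≡excess₁) doubling-0)
          where open Distribution χ2≡-1 refl (legendre-neg-1mod4 1mod4)

        third-3mod4-χ2≡-1 : p % 4 ≡ 3 → χ 2 ≡ -1ℤ → sgn (numN6 p) ≡ sgn (excess 0 + 0) ℤ.* prodLeg p 1 4 1 3
        third-3mod4-χ2≡-1 3mod4 χ2≡-1 = sgn-numN6-* (excess 0 + 0) third (n 5 ℤ.+ + k ℤ.- n 0)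
            (odd-χ2≡-1 {s 0} {s 1} {s 5} {+ k} {+ (excess 0 + 0)} {+ (excess 1 + 0)} {n 0} {n 1} {n 3} {n 5} size₀ size₁ size₅ doubling-0)
          where open Distribution χ2≡-1 refl (legendre-neg-3mod4 3mod4)

      third-3mod4-χ2≡1 : p % 4 ≡ 3 → χ 2 ≡ 1ℤ → ∀ d → List.sum (map excess (1 ∷ 5 ∷ [])) ≡ 2 * d →
        sgn (numN6 p) ≡ sgn d ℤ.* prodLeg p 1 4 1 3
      third-3mod4-χ2≡1 3mod4 χ2≡1 d eq = sgn-numN6-* d third (+ k) (odd-χ2≡1 {s 0} {s 1} {s 5} {+ k} {+ d} {n 1} {n 3} {n 5} doubling-0
        (trans (cellSums-≡ (1 ∷ 5 ∷ [])) (cong (λ t → (t ℤ.+ + 2 ℤ.* (+ 2 ℤ.* + k)) ℤ.- + 2 ℤ.* cellSums isNonresidue (1 ∷ 5 ∷ []))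
          (trans (cong +_ eq) (ℤ.pos-* 2 d)))))
        where open Distribution χ2≡1 refl (legendre-neg-3mod4 3mod4)

    no-nonresidues : (∀ x → x < p → isNonResB p x ≡ false) → ∀ L → cellSums isNonresidue L ≡ 0ℤ
    no-nonresidues none []      = refl
    no-nonresidues none (i ∷ L) = cong₂ ℤ._+_
      (trans (∑ℤ-cong p (λ x x<p → trans (cong (λ b → indicator (cell x ≡ᵇ i) ℤ.* indicator b) (none x x<p)) (ℤ.*-zeroʳ (indicator (cell x ≡ᵇ i))))) (∑ℤ-0 p))
      (no-nonresidues none L)

    cells : List ℕ
    cells = 0 ∷ 1 ∷ 2 ∷ 3 ∷ 4 ∷ 5 ∷ 6 ∷ 7 ∷ 8 ∷ 9 ∷ 10 ∷ 11 ∷ []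

    -- Multiplication by the non-residue u permutes the terms and changes every sign, so the sum is
    -- its own negative.
    legendre-sum : ∀ {u} → Unit u → χ u ≡ -1ℤ → cellSums χ cells ≡ 0ℤ
    legendre-sum {u} uu χu = cancel (cellSums χ cells) (begin
      cellSums χ cells                          ≡⟨ ∑-weighted χ (λ _ → 1ℤ) cells ⟨
      ∑ℤ p (λ x → 1ℤ ℤ.* χ x)                   ≡⟨ ∑-twist uu (λ _ → 1ℤ) ⟩
      χ u ℤ.* ∑ℤ p (λ x → 1ℤ ℤ.* χ x)           ≡⟨ cong₂ ℤ._*_ χu (∑-weighted χ (λ _ → 1ℤ) cells) ⟩
      -1ℤ ℤ.* cellSums χ cells                  ∎)
      where
      open ≡-Reasoning
      cancel : ∀ x → x ≡ -1ℤ ℤ.* x → x ≡ 0ℤ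
      cancel x e = ℤ.*-cancelˡ-≡ (+ 2) _ _ (add-multiple (+ 1) e (ℤ-Solver.solve (x ∷ [])))

    half-legendre-sum : χ neg ≡ 1ℤ → ∀ {u} → Unit u → χ u ≡ -1ℤ → s 0 ℤ.+ s 1 ℤ.+ s 2 ℤ.+ s 3 ℤ.+ s 4 ℤ.+ s 5 ≡ 0ℤ
    half-legendre-sum χneg uu χu = collapse (m 6 (reflection 6)) (m 7 (reflection 7)) (m 8 (reflection 8))
        (m 9 (reflection 9)) (m 10 (reflection 10)) (m 11 (reflection 11)) (legendre-sum uu χu)
      where
      m : ∀ i → s i ≡ χ neg ℤ.* s (11 ∸ i) → s i ≡ s (11 ∸ i)
      m i e = trans e (trans (cong (ℤ._* s (11 ∸ i)) χneg) (ℤ.*-identityˡ _))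
      collapse : ∀ {a b c d e f g h i j k l} → g ≡ f → h ≡ e → i ≡ d → j ≡ c → k ≡ b → l ≡ a →
        a ℤ.+ (b ℤ.+ (c ℤ.+ (d ℤ.+ (e ℤ.+ (f ℤ.+ (g ℤ.+ (h ℤ.+ (i ℤ.+ (j ℤ.+ (k ℤ.+ (l ℤ.+ 0ℤ))))))))))) ≡ 0ℤ →
        a ℤ.+ b ℤ.+ c ℤ.+ d ℤ.+ e ℤ.+ f ≡ 0ℤ
      collapse {a} {b} {c} {d} {e} {f} refl refl refl refl refl refl eq =
        ℤ.*-cancelˡ-≡ (+ 2) _ _ (add-multiple (+ 1) eq (ℤ-Solver.solve (a ∷ b ∷ c ∷ d ∷ e ∷ f ∷ [])))

    -- A prime has non-residues, but if there were none both counts would vanish,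
    -- so their existence need not be proved.
    numN6-24k+1 : ∀ k → p ≡ 1 + 24 * k → sgn (numN6 p) ≡ prodLeg p 0 1 1 12
    numN6-24k+1 k p≡ with anyUpTo? (λ x → isNonResB p x Bool.≟ true) p
    ... | no none = sgn-numN6-≡ zeroth 0ℤ (trans (vanish (1 ∷ 3 ∷ 5 ∷ [])) (sym (trans (ℤ.+-identityʳ _) (vanish (0 ∷ [])))))
      where
      vanish : ∀ L → cellSums isNonresidue L ≡ 0ℤ
      vanish = no-nonresidues (λ x x<p → Bool.¬-not (λ t → none (x , x<p , t)))
    ... | yes (u , u<p , nu) = sgn-numN6-≡ zeroth (N₁₃₅ ℤ.+ n 2 ℤ.- + 3 ℤ.* + k)
        (case1 {s 0} {s 1} {s 2} {s 3} {s 4} {s 5} {+ k} {n 0} {n 1} {n 2} {n 3} {n 5} doubling-1 tripling-0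
          (half-legendre-sum χneg uu χu) (cellSums-≡ (0 ∷ [])) (cellSums-≡ (1 ∷ 3 ∷ 5 ∷ [])) (cellSums-≡ (2 ∷ [])))
      where
      open Residue 1 k p≡
      open Sizes 1 k p≡
      χneg : χ neg ≡ 1ℤ
      χneg = legendre-neg-1mod4 %4
      uu : Unit u
      uu = ≢0⇒Unit u<p λ { refl → contradiction (trans (sym isNonResB-0) nu) λ () }
      χu : χ u ≡ -1ℤ
      χu with classify u uu
      ... | nonresidue χu _ _ = χu
      ... | residue _ e _     = contradiction (trans (sym e) nu) λ ()
      double : ∀ a k → a * (2 * k) ≡ 2 * (a * k)
      double = solve-∀
      -- For r = 1 no excess arises: the two bands hold 3 · 2k and 2 · 2k units, both even, so χ(2)
      -- = χ(3) = 1.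
      open Distribution
        (legendre-2 (3 * k) (trans (count-band-≡ 3 6 (m≤m+n 3 3) (m≤m+n 7 5)) (double 3 k)))
        (legendre-3 (2 * k) (trans (count-band-≡ 2 4 (m≤m+n 2 2) (m≤m+n 5 7)) (double 2 k))) χneg

    numN6-24k+19 : ∀ k → p ≡ 19 + 24 * k → sgn (numN6 p) ≡ sgn (k + 1)
    numN6-24k+19 k p≡ = sgn-numN6 {k + 1} (+ 1 ℤ.+ + k) refl
      (case19 {s 1} {s 2} {s 3} {s 4} {s 5} {+ k} {N₁₃₅} doubling-1 tripling-1 (cellSums-≡ (1 ∷ 3 ∷ 5 ∷ [])))
      where
      open Residue 19 k p≡
      open Sizes 19 k p≡
      open Mod3 %4
      -- For r = 19 the cells 3, 4, 5 have excess 5 = 1 + 2 · 2, and the cells 2, 3 have excess 3 =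
      -- 1 + 2 · 1.
      open Distribution (χ2≡-1 2 refl) (χ3≡-1 1 refl) χneg

    numN6-24k+23 : ∀ k → p ≡ 23 + 24 * k → sgn (numN6 p) ≡ sgn (k + 1)
    numN6-24k+23 k p≡ = sgn-numN6 {k + 1} (+ 1 ℤ.+ + k) refl
      (case23 {s 0} {s 1} {s 2} {s 3} {s 4} {s 5} {+ k} {N₁₃₅} doubling-0 doubling-2 tripling-0 (cellSums-≡ (1 ∷ 3 ∷ 5 ∷ [])))
      where
      open Residue 23 k p≡
      open Sizes 23 k p≡
      open Mod3 %4
      open Distribution (χ2≡1 2 refl) (χ3≡1 3 refl) χneg

    numN6-24k+7 : ∀ k → p ≡ 7 + 24 * k → sgn (numN6 p) ≡ sgn k ℤ.* prodLeg p 0 1 1 2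
    numN6-24k+7 k p≡ = sgn-numN6-* k half (- (+ 2 ℤ.* + k))
      (case7 {s 0} {s 1} {s 2} {s 3} {s 4} {s 5} {+ k} {N₁₃₅} {cellSums isNonresidue (0 ∷ 1 ∷ 2 ∷ 3 ∷ 4 ∷ 5 ∷ [])}
        doubling-1 tripling-0 (cellSums-≡ (1 ∷ 3 ∷ 5 ∷ [])) (cellSums-≡ (0 ∷ 1 ∷ 2 ∷ 3 ∷ 4 ∷ 5 ∷ [])))
      where
      open Residue 7 k p≡
      open Sizes 7 k p≡
      open Mod3 %4
      open Distribution (χ2≡1 0 refl) (χ3≡-1 0 refl) χneg

    numN6-24k+11 : ∀ k → p ≡ 11 + 24 * k → sgn (numN6 p) ≡ sgn (k + 1) ℤ.* prodLeg p 0 1 1 2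
    numN6-24k+11 k p≡ = sgn-numN6-* (k + 1) half (- (+ 1 ℤ.+ + 2 ℤ.* + k))
      (case11 {s 0} {s 1} {s 2} {s 3} {s 4} {s 5} {+ k} {N₁₃₅} {cellSums isNonresidue (0 ∷ 1 ∷ 2 ∷ 3 ∷ 4 ∷ 5 ∷ [])}
        doubling-0 doubling-2 tripling-1 (cellSums-≡ (1 ∷ 3 ∷ 5 ∷ [])) (cellSums-≡ (0 ∷ 1 ∷ 2 ∷ 3 ∷ 4 ∷ 5 ∷ [])))
      where
      open Residue 11 k p≡
      open Sizes 11 k p≡
      open Mod3 %4
      open Distribution (χ2≡-1 1 refl) (χ3≡1 1 refl) χneg

    private
      r k : ℕ
      r = p % 24
      k = p / 24

      p≡ : p ≡ r + 24 * k
      p≡ = trans (m≡m%n+[m/n]*n p 24) (cong (λ t → r + t) (*-comm k 24))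

      r%3≢0 : r % 3 ≢ 0
      r%3≢0 e with prime⇒irreducible prime (m%n≡0⇒n∣m p 3 (trans (sym (m∣n⇒o%n%m≡o%m 3 24 p (divides 8 refl))) e))
      ... | inj₂ 3≡p = contradiction 10<p (≤⇒≯ (subst (_≤ 10) 3≡p (m≤m+n 3 7)))

      r%4≡ : r % 4 ≡ p % 4
      r%4≡ = m∣n⇒o%n%m≡o%m 4 24 p (divides 6 refl)

      classes-1mod4 : ∀ {r} → r < 24 → r % 4 ≡ 1 → r % 3 ≢ 0 → r ≡ 1 ⊎ r ≡ 5 ⊎ r ≡ 13 ⊎ r ≡ 17
      classes-1mod4 = toWitness {a? = allUpTo? (λ r → (r % 4 ≟ 1) →-dec (¬? (r % 3 ≟ 0) →-dec
        ((r ≟ 1) ⊎-dec ((r ≟ 5) ⊎-dec ((r ≟ 13) ⊎-dec (r ≟ 17)))))) 24} _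

      classes-3mod4 : ∀ {r} → r < 24 → r % 4 ≡ 3 → r % 3 ≢ 0 → r ≡ 7 ⊎ r ≡ 11 ⊎ r ≡ 19 ⊎ r ≡ 23
      classes-3mod4 = toWitness {a? = allUpTo? (λ r → (r % 4 ≟ 3) →-dec (¬? (r % 3 ≟ 0) →-dec
        ((r ≟ 7) ⊎-dec ((r ≟ 11) ⊎-dec ((r ≟ 19) ⊎-dec (r ≟ 23)))))) 24} _

      p≡′ : ∀ {c} → r ≡ c → p ≡ c + 24 * k
      p≡′ refl = p≡

    numN6-4k+1 : p % 4 ≡ 1 → sgn (numN6 p) ≡ prodLeg p 1 4 1 3
    numN6-4k+1 1mod4 with classes-1mod4 (m%n<n p 24) (trans r%4≡ 1mod4) r%3≢0
    ... | inj₁ e               = Residue.third-1mod4 1 k (p≡′ e) refl 1mod4 refl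
    ... | inj₂ (inj₁ e)        = Residue.third-1mod4 5 k (p≡′ e) refl 1mod4 refl
    ... | inj₂ (inj₂ (inj₁ e)) = Residue.third-1mod4 13 k (p≡′ e) refl 1mod4 refl
    ... | inj₂ (inj₂ (inj₂ e)) = Residue.third-1mod4 17 k (p≡′ e) refl 1mod4 refl

    -- The sign comes from cell sizes: half the joint excess of cells 1 and 5 if χ(2) = 1, the
    -- excess of cell 0 if χ(2) = -1. For r = 7, 11, 19, 23 it is -1, 1, -1, 1, which is the forced
    -- value of χ(3) each time.
    numN6-4k+3 : p % 4 ≡ 3 → sgn (numN6 p) ≡ χ 3 ℤ.* prodLeg p 1 4 1 3
    numN6-4k+3 3mod4 with classes-3mod4 (m%n<n p 24) (trans r%4≡ 3mod4) r%3≢0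
    ... | inj₁ e = trans (third-3mod4-χ2≡1 3mod4 (χ2≡1 0 refl) 1 refl) (cong (ℤ._* prodLeg p 1 4 1 3) (sym (χ3≡-1 0 refl)))
      where
      open Residue 7 k (p≡′ e)
      open Mod3 3mod4
    ... | inj₂ (inj₁ e) = trans (third-3mod4-χ2≡-1 refl 3mod4 (χ2≡-1 1 refl)) (cong (ℤ._* prodLeg p 1 4 1 3) (sym (χ3≡1 1 refl)))
      where
      open Residue 11 k (p≡′ e)
      open Mod3 3mod4
    ... | inj₂ (inj₂ (inj₁ e)) = trans (third-3mod4-χ2≡-1 refl 3mod4 (χ2≡-1 2 refl)) (cong (ℤ._* prodLeg p 1 4 1 3) (sym (χ3≡-1 1 refl)))
      where
      open Residue 19 k (p≡′ e)
      open Mod3 3mod4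
    ... | inj₂ (inj₂ (inj₂ e)) = trans (third-3mod4-χ2≡1 3mod4 (χ2≡1 2 refl) 2 refl) (cong (ℤ._* prodLeg p 1 4 1 3) (sym (χ3≡1 3 refl)))
      where
      open Residue 23 k (p≡′ e)
      open Mod3 3mod4

theorem4p12 : (p : ℕ) → Prime p → 10 < p →
    ((p % 4 ≡ 1 → sgn (numN6 p) ≡ prodLeg p 1 4 1 3)
    × (p % 4 ≡ 3 → sgn (numN6 p) ≡ legendre p 3 *ℤ prodLeg p 1 4 1 3))
    × ((k : ℕ) →
    (p ≡ 1 + 24 * k → sgn (numN6 p) ≡ prodLeg p 0 1 1 12)
    × (p ≡ 19 + 24 * k → sgn (numN6 p) ≡ sgn (k + 1))
    × (p ≡ 23 + 24 * k → sgn (numN6 p) ≡ sgn (k + 1))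
    × (p ≡ 7 + 24 * k → sgn (numN6 p) ≡ sgn k *ℤ prodLeg p 0 1 1 2)
    × (p ≡ 11 + 24 * k → sgn (numN6 p) ≡ sgn (k + 1) *ℤ prodLeg p 0 1 1 2))
theorem4p12 p p-prime 10<p =
  (numN6-4k+1 , numN6-4k+3) ,
  λ k → numN6-24k+1 k , numN6-24k+19 k , numN6-24k+23 k , numN6-24k+7 k , numN6-24k+11 k
  where
  open Proof p p-prime 10<p
  open Cases
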